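{- For every three-dimensional real inner-product space $V$, every full-rank lattice $\mathcal L\subset V$, every $\boldsymbol\alpha\in V$, and every integer $N\ge 2$, $$ g_N(\boldsymbol\alpha,\mathcal L)\le 9. $$
   Context: Let $V$ be a finite-dimensional real inner-product space with induced norm $\|\cdot\|$, $\mathcal L\subset V$ a full-rank lattice (a discrete subgroup spanning $V$), and $\boldsymbol\alpha\in V$. For integers $N\ge 2$ and $1\le n\le N$, set $$\delta_{n,N}=\min\{\|(m-n)\boldsymbol\alpha+\ell\| : m\in\mathbb Z,\ 1\le m\le N,\ \ell\in\mathcal L,\ (m-n)\boldsymbol\alpha+\ell\neq 0\}.$$ (The choice $m=n$ is allowed, in which case $\ell$ is a nonzero lattice vector.) Define $g_N(\boldsymbol\alpha,\mathcal L)=\#\{\delta_{n,N}:1\le n\le N\}$, the number of distinct values among $\delta_{1,N},\dots,\delta_{N,N}$. -}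

module Defs where

open import Algebra.Bundles using (CommutativeRing)
open import Algebra.Module.Bundles using (Module)
import Algebra.Properties.Monoid.Sum as MonoidSum
open import Data.Empty using (⊥-elim)
open import Data.Fin.Base using (Fin; zero; suc)
open import Data.Fin.Properties using (injective⇒≤)
open import Data.Integer.Base as ℤ using (ℤ; +_; -[1+_]; +[1+_]; _⊖_)
import Data.Integer.Properties as ℤ
import Data.Integer.Tactic.RingSolver as ℤ-Solver
open import Data.Nat.Base as ℕ using (ℕ; zero; suc)
import Data.Nat.Coprimality as Coprime
import Data.Nat.Properties as ℕ
open import Data.Product.Base using (∃; ∃-syntax; _×_; _,_; proj₁; proj₂)
open import Data.Rational.Base as ℚ using (ℚ; mkℚ; 0ℚ; 1ℚ; ½)
import Data.Rational.Properties as ℚ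
open import Data.Rational.Solver using (module +-*-Solver)
import Data.Rational.Unnormalised.Base as ℚᵘ
import Data.Rational.Unnormalised.Properties as ℚᵘ
open import Data.Sum.Base using (inj₁; inj₂)
open import Data.Vec.Functional using (Vector; _∷_)
open import Function.Base using (_∘_; case_of_)
open import Function.Definitions using (Injective)
open import Level using (Level; 0ℓ; _⊔_) renaming (suc to lsuc)
open import Relation.Binary.Structures using (IsEquivalence)
open import Relation.Binary.PropositionalEquality.Core
  using (_≡_; refl; sym; trans; cong; cong₂; subst; subst₂)
open import Relation.Nullary.Decidable.Core using (yes; no)
open import Relation.Nullary.Negation.Core using (¬_)
open import Relation.Unary using (Pred; _∈_; Decidable)

------------------------------------------------------------------------
-- Auxiliary facts about ℚ

module ℚ-Lemmas where

  open import Data.Rational.Base using (_+_; _*_; _-_; -_; ∣_∣; _≤_; _<_)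
  open ℚ.≤-Reasoning
  open +-*-Solver using (solve; _:=_; _:+_; _:*_; _:-_; :-_; con)

  ≤-by : ∀ {p q} r → 0ℚ ≤ r → p + r ≡ q → p ≤ q
  ≤-by {p} {q} r 0≤r eq =
    subst₂ _≤_ (ℚ.+-identityʳ p) eq (ℚ.+-monoʳ-≤ p 0≤r)

  0≤+ : ∀ {p q} → 0ℚ ≤ p → 0ℚ ≤ q → 0ℚ ≤ p + q
  0≤+ = ℚ.+-mono-≤

  0≤* : ∀ {p q} → 0ℚ ≤ p → 0ℚ ≤ q → 0ℚ ≤ p * q
  0≤* {p} {q} 0≤p 0≤q = subst (_≤ p * q) (ℚ.*-zeroʳ p)
    (ℚ.*-monoˡ-≤-nonNeg p {{ℚ.nonNegative 0≤p}} 0≤q)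

  0<* : ∀ {p q} → 0ℚ < p → 0ℚ < q → 0ℚ < p * q
  0<* {p} {q} 0<p 0<q = subst (_< p * q) (ℚ.*-zeroʳ p)
    (ℚ.*-monoʳ-<-pos p {{ℚ.positive 0<p}} 0<q)

  *-mono : ∀ {p q r s} → 0ℚ ≤ p → 0ℚ ≤ s → p ≤ q → r ≤ s → p * r ≤ q * s
  *-mono {p} {q} {r} {s} 0≤p 0≤s p≤q r≤s = ℚ.≤-trans
    (ℚ.*-monoˡ-≤-nonNeg p {{ℚ.nonNegative 0≤p}} r≤s)
    (ℚ.*-monoʳ-≤-nonNeg s {{ℚ.nonNegative 0≤s}} p≤q)

  0≤diff : ∀ {p q} → p ≤ q → 0ℚ ≤ q - p
  0≤diff {p} {q} p≤q =
    subst (_≤ q - p) (ℚ.+-inverseʳ p) (ℚ.+-monoˡ-≤ (- p) p≤q)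

  0≤1 : 0ℚ ≤ 1ℚ
  0≤1 = ℚ.≤ᵇ⇒≤ _

  0<1 : 0ℚ < 1ℚ
  0<1 = ℚ.positive⁻¹ 1ℚ

  0<½ : 0ℚ < ½
  0<½ = ℚ.positive⁻¹ ½

  half : ∀ {ε} → 0ℚ < ε → 0ℚ < ½ * ε
  half = 0<* 0<½

  ½+½ : ∀ ε → ½ * ε + ½ * ε ≡ ε
  ½+½ = solve 1 (λ e → con ½ :* e :+ con ½ :* e := e) refl

  p≤∣p∣ : ∀ p → p ≤ ∣ p ∣
  p≤∣p∣ p with ℚ.≤-total 0ℚ p
  ... | inj₁ 0≤p = ℚ.≤-reflexive (sym (ℚ.0≤p⇒∣p∣≡p 0≤p))
  ... | inj₂ p≤0 = ℚ.≤-trans p≤0 (ℚ.0≤∣p∣ p)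

  ∣p-q∣≡∣q-p∣ : ∀ p q → ∣ p - q ∣ ≡ ∣ q - p ∣
  ∣p-q∣≡∣q-p∣ p q = trans
    (cong ∣_∣ (solve 2 (λ a b → a :- b := :- (b :- a)) refl p q))
    (ℚ.∣-p∣≡∣p∣ (q - p))

  near⇒≤ : ∀ {p q ε} → ∣ p - q ∣ ≤ ε → p ≤ q + ε
  near⇒≤ {p} {q} {ε} h = ≤-by (ε - (p - q))
    (0≤diff (ℚ.≤-trans (p≤∣p∣ (p - q)) h))
    (solve 3 (λ a b e → a :+ (e :- (a :- b)) := b :+ e) refl p q ε)

  near⇒≥ : ∀ {p q ε} → ∣ p - q ∣ ≤ ε → q ≤ p + ε
  near⇒≥ {p} {q} {ε} h = near⇒≤ (subst (_≤ ε) (∣p-q∣≡∣q-p∣ p q) h)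

  ≤⇒near : ∀ {p q ε} → p ≤ q + ε → q ≤ p + ε → ∣ p - q ∣ ≤ ε
  ≤⇒near {p} {q} {ε} h₁ h₂ with ℚ.∣p∣≡p∨∣p∣≡-p (p - q)
  ... | inj₁ eq = subst (_≤ ε) (sym eq) (≤-by _ (0≤diff h₁)
    (solve 3 (λ a b e → (a :- b) :+ ((b :+ e) :- a) := e) refl p q ε))
  ... | inj₂ eq = subst (_≤ ε) (sym eq) (≤-by _ (0≤diff h₂)
    (solve 3 (λ a b e → (:- (a :- b)) :+ ((a :+ e) :- b) := e) refl p q ε))

  near-refl : ∀ p {ε} → 0ℚ < ε → ∣ p - p ∣ ≤ ε
  near-refl p 0<ε =
    subst (_≤ _) (sym (cong ∣_∣ (ℚ.+-inverseʳ p))) (ℚ.<⇒≤ 0<ε)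

  near-trans : ∀ {p q r ε δ} → ∣ p - q ∣ ≤ ε → ∣ q - r ∣ ≤ δ → ∣ p - r ∣ ≤ ε + δ
  near-trans {p} {q} {r} {ε} {δ} h₁ h₂ = begin
    ∣ p - r ∣              ≡⟨ cong ∣_∣ (solve 3 (λ a b c →
                                a :- c := (a :- b) :+ (b :- c)) refl p q r) ⟩
    ∣ (p - q) + (q - r) ∣  ≤⟨ ℚ.∣p+q∣≤∣p∣+∣q∣ (p - q) (q - r) ⟩
    ∣ p - q ∣ + ∣ q - r ∣  ≤⟨ ℚ.+-mono-≤ h₁ h₂ ⟩
    ε + δ                  ∎

  near-+ : ∀ {p q r s ε δ} → ∣ p - q ∣ ≤ ε → ∣ r - s ∣ ≤ δ →
           ∣ (p + r) - (q + s) ∣ ≤ ε + δ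
  near-+ {p} {q} {r} {s} {ε} {δ} h₁ h₂ = begin
    ∣ (p + r) - (q + s) ∣  ≡⟨ cong ∣_∣ (solve 4 (λ a b c d →
                                (a :+ c) :- (b :+ d) := (a :- b) :+ (c :- d))
                                refl p q r s) ⟩
    ∣ (p - q) + (r - s) ∣  ≤⟨ ℚ.∣p+q∣≤∣p∣+∣q∣ (p - q) (r - s) ⟩
    ∣ p - q ∣ + ∣ r - s ∣  ≤⟨ ℚ.+-mono-≤ h₁ h₂ ⟩
    ε + δ                  ∎

  near-neg : ∀ {p q ε} → ∣ p - q ∣ ≤ ε → ∣ (- p) - (- q) ∣ ≤ ε
  near-neg {p} {q} {ε} h = subst (_≤ ε) (trans (∣p-q∣≡∣q-p∣ p q) (cong ∣_∣
    (solve 2 (λ a b → b :- a := (:- a) :- (:- b)) refl p q))) h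

  near-* : ∀ {p q r s B C ε δ} → ∣ p ∣ ≤ B → ∣ s ∣ ≤ C →
           ∣ p - q ∣ ≤ ε → ∣ r - s ∣ ≤ δ → ∣ p * r - q * s ∣ ≤ B * δ + C * ε
  near-* {p} {q} {r} {s} {B} {C} {ε} {δ} hp hs h₁ h₂ = begin
    ∣ p * r - q * s ∣                      ≡⟨ cong ∣_∣ (solve 4 (λ a b c d →
                                                a :* c :- b :* d :=
                                                a :* (c :- d) :+ d :* (a :- b))
                                                refl p q r s) ⟩
    ∣ p * (r - s) + s * (p - q) ∣          ≤⟨ ℚ.∣p+q∣≤∣p∣+∣q∣ (p * (r - s)) _ ⟩
    ∣ p * (r - s) ∣ + ∣ s * (p - q) ∣      ≡⟨ cong₂ _+_ (ℚ.∣p*q∣≡∣p∣*∣q∣ p _)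
                                                        (ℚ.∣p*q∣≡∣p∣*∣q∣ s _) ⟩
    ∣ p ∣ * ∣ r - s ∣ + ∣ s ∣ * ∣ p - q ∣
      ≤⟨ ℚ.+-mono-≤
           (*-mono (ℚ.0≤∣p∣ p) (ℚ.≤-trans (ℚ.0≤∣p∣ (r - s)) h₂) hp h₂)
           (*-mono (ℚ.0≤∣p∣ s) (ℚ.≤-trans (ℚ.0≤∣p∣ (p - q)) h₁) hs h₁) ⟩
    B * δ + C * ε                          ∎

  shrink : ∀ B {ε} → 0ℚ < B → 0ℚ < ε → ∃[ δ ] 0ℚ < δ × B * δ ≡ ε
  shrink B {ε} 0<B 0<ε = B⁻¹ * ε , 0<* 0<B⁻¹ 0<ε , (begin-equality
    B * (B⁻¹ * ε)  ≡⟨ ℚ.*-assoc B B⁻¹ ε ⟨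
    (B * B⁻¹) * ε  ≡⟨ cong (_* ε) (ℚ.*-inverseʳ B) ⟩
    1ℚ * ε         ≡⟨ ℚ.*-identityˡ ε ⟩
    ε              ∎)
    where
    instance
      B-pos = ℚ.positive 0<B
      B≢0 = ℚ.pos⇒nonZero B
    B⁻¹ = ℚ.1/ B
    0<B⁻¹ : 0ℚ < B⁻¹
    0<B⁻¹ = ℚ.positive⁻¹ B⁻¹ {{ℚ.1/pos⇒pos B}}

  ι : ℕ → ℚ
  ι n = mkℚ (+ n) 0 (Coprime.sym (Coprime.1-coprimeTo n))

  1/1+_ : ℕ → ℚ
  1/1+ n = mkℚ (+ 1) n (Coprime.1-coprimeTo (suc n))

  0<1/1+ : ∀ n → 0ℚ < 1/1+ n
  0<1/1+ n = ℚ.positive⁻¹ (1/1+ n)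

  ι-suc : ∀ n → ι (suc n) ≡ ι n + 1ℚ
  ι-suc n = ℚ.toℚᵘ-injective (ℚᵘ.≃-trans
    (ℚᵘ.*≡* (lemma (+ n)))
    (ℚᵘ.≃-sym (ℚ.toℚᵘ-homo-+ (ι n) 1ℚ)))
    where
    lemma : ∀ i → (+ 1 ℤ.+ i) ℤ.* (+ 1) ≡ (i ℤ.* + 1 ℤ.+ + 1 ℤ.* + 1) ℤ.* + 1
    lemma = ℤ-Solver.solve-∀

  ι-* : ∀ m n → ι (m ℕ.* n) ≡ ι m * ι n
  ι-* m n = ℚ.toℚᵘ-injective (ℚᵘ.≃-trans
    (ℚᵘ.*≡* (cong (ℤ._* + 1) (ℤ.pos-* m n)))
    (ℚᵘ.≃-sym (ℚ.toℚᵘ-homo-* (ι m) (ι n))))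

  ι-1/1+ : ∀ n → ι (suc n) * 1/1+ n ≡ 1ℚ
  ι-1/1+ n = ℚ.toℚᵘ-injective (ℚᵘ.≃-trans
    (ℚ.toℚᵘ-homo-* (ι (suc n)) (1/1+ n))
    (ℚᵘ.*≡* (lemma (+ suc n))))
    where
    lemma : ∀ i → (i ℤ.* + 1) ℤ.* + 1 ≡ + 1 ℤ.* (+ 1 ℤ.* i)
    lemma = ℤ-Solver.solve-∀

  ι-nonNeg : ∀ n → 0ℚ ≤ ι n
  ι-nonNeg n = ℚ.nonNegative⁻¹ (ι n)

  archimedean : ∀ {ε} → 0ℚ < ε → ∃[ N ] ∀ {n} → N ℕ.≤ n → 1/1+ n ≤ ε
  archimedean {mkℚ +[1+ a ] d _} 0<ε = d , λ {n} d≤n → ℚ.*≤*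
    (ℤ.+≤+ (subst (ℕ._≤ suc a ℕ.* suc n) (sym (ℕ.*-identityˡ (suc d)))
      (ℕ.≤-trans (ℕ.s≤s d≤n) (ℕ.m≤n*m (suc n) (suc a)))))
  archimedean {mkℚ (+ 0) d _} (ℚ.*<* (ℤ.+<+ ()))
  archimedean {mkℚ -[1+ a ] d _} (ℚ.*<* ())

  bound : ∀ q → q ≤ ι ℤ.∣ ℚ.↥ q ∣
  bound (mkℚ (+ a) d _) = ℚ.*≤* (ℤ.≤-trans
    (ℤ.≤-reflexive (ℤ.*-identityʳ (+ a)))
    (subst (+ a ℤ.≤_) (ℤ.pos-* a (suc d)) (ℤ.+≤+ (ℕ.m≤m*n a (suc d)))))
  bound (mkℚ -[1+ a ] d _) = ℚ.*≤* ℤ.-≤+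

  crossing : ∀ {P : Pred ℕ 0ℓ} → Decidable P → P 0 → ∀ n → ¬ P n →
             ∃[ t ] P t × ¬ P (suc t)
  crossing P? P0 zero    ¬P0 = ⊥-elim (¬P0 P0)
  crossing P? P0 (suc n) ¬Pn with P? n
  ... | yes Pn = n , Pn , ¬Pn
  ... | no ¬Pn′ = crossing P? P0 n ¬Pn′

  square-cancel-≤ : ∀ {a c} → 0ℚ ≤ c → a * a ≤ c * c → a ≤ c
  square-cancel-≤ {a} {c} 0≤c h with a ℚ.≤? c
  ... | yes a≤c = a≤c
  ... | no  a≰c = ⊥-elim (ℚ.<-irrefl refl (begin-strict
    c * c  ≤⟨ ℚ.*-monoˡ-≤-nonNeg c {{ℚ.nonNegative 0≤c}} (ℚ.<⇒≤ c<a) ⟩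
    c * a  <⟨ ℚ.*-monoˡ-<-pos a {{ℚ.positive (ℚ.≤-<-trans 0≤c c<a)}} c<a ⟩
    a * a  ≤⟨ h ⟩
    c * c  ∎))
    where c<a = ℚ.≰⇒> a≰c

  root′ : ∀ q → 0ℚ ≤ q → ∀ n →
         ∃[ s ] 0ℚ ≤ s × s * s ≤ q × q ≤ (s + 1/1+ n) * (s + 1/1+ n)
  root′ q 0≤q n = s , 0≤* (ι-nonNeg t) (ℚ.<⇒≤ (0<1/1+ n)) , lower , upper
    where
    δ = 1/1+ n
    m = ℤ.∣ ℚ.↥ q ∣

    P : Pred ℕ 0ℓ
    P t = (ι t * δ) * (ι t * δ) ≤ q

    P0 : P 0
    P0 = subst (_≤ q) (solve 1 (λ d → con 0ℚ := (con 0ℚ :* d) :* (con 0ℚ :* d)) refl δ) 0≤q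

    large : ι (suc m ℕ.* suc n) * δ ≡ ι m + 1ℚ
    large = begin-equality
      ι (suc m ℕ.* suc n) * δ      ≡⟨ cong (_* δ) (ι-* (suc m) (suc n)) ⟩
      ι (suc m) * ι (suc n) * δ    ≡⟨ ℚ.*-assoc (ι (suc m)) (ι (suc n)) δ ⟩
      ι (suc m) * (ι (suc n) * δ)  ≡⟨ cong (ι (suc m) *_) (ι-1/1+ n) ⟩
      ι (suc m) * 1ℚ               ≡⟨ ℚ.*-identityʳ (ι (suc m)) ⟩
      ι (suc m)                    ≡⟨ ι-suc m ⟩
      ι m + 1ℚ                     ∎

    ¬P : ¬ P (suc m ℕ.* suc n)
    ¬P h = ℚ.<-irrefl refl (begin-strict
      q                                    ≤⟨ bound q ⟩
      ι m                                  ≡⟨ ℚ.+-identityʳ (ι m) ⟨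
      ι m + 0ℚ                             <⟨ ℚ.+-monoʳ-< (ι m) 0<1 ⟩
      ι m + 1ℚ                             ≤⟨ ≤-by (ι m * ι m + ι m)
                                                (0≤+ (0≤* (ι-nonNeg m) (ι-nonNeg m)) (ι-nonNeg m))
                                                (solve 1 (λ x → (x :+ con 1ℚ) :+ (x :* x :+ x) :=
                                                   (x :+ con 1ℚ) :* (x :+ con 1ℚ)) refl (ι m)) ⟩
      (ι m + 1ℚ) * (ι m + 1ℚ)              ≡⟨ cong₂ _*_ large large ⟨
      (ι (suc m ℕ.* suc n) * δ) * (ι (suc m ℕ.* suc n) * δ)  ≤⟨ h ⟩
      q                                    ∎)

    crossed = crossing {P} (λ t → _ ℚ.≤? q) P0 (suc m ℕ.* suc n) ¬P
    t = proj₁ crossed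
    s = ι t * δ

    lower : s * s ≤ q
    lower = proj₁ (proj₂ crossed)

    next : ι (suc t) * δ ≡ s + δ
    next = trans (cong (_* δ) (ι-suc t))
      (solve 2 (λ a d → (a :+ con 1ℚ) :* d := a :* d :+ d) refl (ι t) δ)

    upper : q ≤ (s + δ) * (s + δ)
    upper = subst (λ u → q ≤ u * u) next
      (ℚ.<⇒≤ (ℚ.≰⇒> (proj₂ (proj₂ crossed))))

  abstract
    root : ∀ q → 0ℚ ≤ q → ∀ n →
           ∃[ s ] 0ℚ ≤ s × s * s ≤ q × q ≤ (s + 1/1+ n) * (s + 1/1+ n)
    root = root′

  root-mono : ∀ {p q a c ε} → 0ℚ ≤ c → 0ℚ ≤ ε → a * a ≤ p → q ≤ c * c →
              p ≤ q + ε * ε → a ≤ c + ε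
  root-mono {p} {q} {a} {c} {ε} 0≤c 0≤ε a²≤p q≤c² h =
    square-cancel-≤ (0≤+ 0≤c 0≤ε) (begin
      a * a              ≤⟨ a²≤p ⟩
      p                  ≤⟨ h ⟩
      q + ε * ε          ≤⟨ ℚ.+-monoˡ-≤ (ε * ε) q≤c² ⟩
      c * c + ε * ε      ≤⟨ ≤-by (c * ε + c * ε) (0≤+ (0≤* 0≤c 0≤ε) (0≤* 0≤c 0≤ε))
                              (solve 2 (λ c e → (c :* c :+ e :* e) :+ (c :* e :+ c :* e)
                                 := (c :+ e) :* (c :+ e)) refl c ε) ⟩
      (c + ε) * (c + ε)  ∎)

  ⊔0-≤ : ∀ {p q ε} → 0ℚ ≤ ε → p ≤ q + ε → p ℚ.⊔ 0ℚ ≤ (q ℚ.⊔ 0ℚ) + ε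
  ⊔0-≤ {p} {q} {ε} 0≤ε h = ℚ.⊔-lub
    (ℚ.≤-trans h (ℚ.+-monoˡ-≤ ε (ℚ.p≤p⊔q q 0ℚ)))
    (0≤+ (ℚ.p≤q⊔p q 0ℚ) 0≤ε)

------------------------------------------------------------------------
-- The real numbers: Cauchy sequences of rationals, with the setoid
-- equality _≈_ of sequences whose difference tends to 0. Proofs of the
-- Cauchy property, and the witnesses of `root`, are abstract only to keep
-- unification from unfolding them.

open ℚ-Lemmas

IsCauchy : (ℕ → ℚ) → Set
IsCauchy s = ∀ ε → 0ℚ ℚ.< ε → ∃[ N ] ∀ m n → N ℕ.≤ m → N ℕ.≤ n →
             ℚ.∣ s m ℚ.- s n ∣ ℚ.≤ ε

record ℝ : Set where
  no-eta-equality
  constructor real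
  field
    seq    : ℕ → ℚ
    cauchy : IsCauchy seq

open ℝ public

infix 4 _≈_ _≤_ _<_

record _≈_ (x y : ℝ) : Set where
  constructor ≈-intro
  field
    ≈-elim : ∀ ε → 0ℚ ℚ.< ε → ∃[ N ] ∀ n → N ℕ.≤ n →
             ℚ.∣ seq x n ℚ.- seq y n ∣ ℚ.≤ ε

record _≤_ (x y : ℝ) : Set where
  constructor ≤-intro
  field
    ≤-elim : ∀ ε → 0ℚ ℚ.< ε → ∃[ N ] ∀ n → N ℕ.≤ n →
             seq x n ℚ.≤ seq y n ℚ.+ ε

record _<_ (x y : ℝ) : Set where
  constructor <-intro
  field
    <-elim : ∃[ ε ] 0ℚ ℚ.< ε × ∃[ N ] ∀ n → N ℕ.≤ n →
             seq x n ℚ.+ ε ℚ.≤ seq y n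

open _≈_ public
open _≤_ public
open _<_ public

≤-antisym : ∀ {x y} → x ≤ y → y ≤ x → x ≈ y
≤-antisym {x} {y} h k = ≈-intro λ ε 0<ε →
  let M , f = ≤-elim h ε 0<ε
      N , g = ≤-elim k ε 0<ε
  in M ℕ.⊔ N , λ n n≥ → ≤⇒near {seq x n} {seq y n}
       (f n (ℕ.m⊔n≤o⇒m≤o M N n≥)) (g n (ℕ.m⊔n≤o⇒n≤o M N n≥))

fromℚ : ℚ → ℝ
fromℚ q = real (λ _ → q) (λ ε 0<ε → 0 , λ _ _ _ _ → near-refl q 0<ε)

0ℝ 1ℝ : ℝ
0ℝ = fromℚ 0ℚ
1ℝ = fromℚ 1ℚ

fromℤ : ℤ → ℝ
fromℤ i = fromℚ (i ℚ./ 1)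

≗⇒≈ : ∀ {x y} → (∀ n → seq x n ≡ seq y n) → x ≈ y
≗⇒≈ {x} h = ≈-intro λ ε 0<ε → 0 , λ n _ →
  subst (λ q → ℚ.∣ seq x n ℚ.- q ∣ ℚ.≤ ε) (h n) (near-refl (seq x n) 0<ε)

≈-refl : ∀ {x} → x ≈ x
≈-refl = ≗⇒≈ (λ _ → refl)

≈-sym : ∀ {x y} → x ≈ y → y ≈ x
≈-sym {x} {y} h = ≈-intro λ ε 0<ε → let N , f = ≈-elim h ε 0<ε in N , λ n N≤n →
  subst (ℚ._≤ ε) (∣p-q∣≡∣q-p∣ (seq x n) (seq y n)) (f n N≤n)

≈-trans : ∀ {x y z} → x ≈ y → y ≈ z → x ≈ z
≈-trans {x} {y} {z} h k = ≈-intro λ ε 0<ε →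
  let M , f = ≈-elim h (½ ℚ.* ε) (half 0<ε)
      N , g = ≈-elim k (½ ℚ.* ε) (half 0<ε)
  in M ℕ.⊔ N , λ n M⊔N≤n →
     subst (_ ℚ.≤_) (½+½ ε) (near-trans {seq x n} {seq y n} {seq z n}
       (f n (ℕ.m⊔n≤o⇒m≤o M N M⊔N≤n)) (g n (ℕ.m⊔n≤o⇒n≤o M N M⊔N≤n)))

eventually-bounded : ∀ x → ∃[ B ] 0ℚ ℚ.< B × ∃[ N ] ∀ n → N ℕ.≤ n →
                     ℚ.∣ seq x n ∣ ℚ.≤ B
eventually-bounded x =
  let N , f = cauchy x 1ℚ 0<1
      a     = seq x N
  in ℚ.∣ a ∣ ℚ.+ 1ℚ ,
     ℚ.+-mono-≤-< (ℚ.0≤∣p∣ a) 0<1 ,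
     N , λ n N≤n →
       subst (λ q → ℚ.∣ q ∣ ℚ.≤ ℚ.∣ a ∣ ℚ.+ 1ℚ) (split (seq x n) a)
         (ℚ.≤-trans (ℚ.∣p+q∣≤∣p∣+∣q∣ a (seq x n ℚ.- a))
           (ℚ.+-monoʳ-≤ ℚ.∣ a ∣ (f n N N≤n ℕ.≤-refl)))
  where
  open +-*-Solver
  split : ∀ p a → a ℚ.+ (p ℚ.- a) ≡ p
  split = solve 2 (λ p a → a :+ (p :- a) := p) refl

infixl 6 _+_
infixl 7 _*_
infix  8 -_

abstract
  +-cauchy : ∀ x y → IsCauchy (λ n → seq x n ℚ.+ seq y n)
  +-cauchy x y ε 0<ε =
    let M , f = cauchy x (½ ℚ.* ε) (half 0<ε)
        N , g = cauchy y (½ ℚ.* ε) (half 0<ε)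
    in M ℕ.⊔ N , λ m n m≥ n≥ →
       subst (_ ℚ.≤_) (½+½ ε)
         (near-+ {seq x m} {seq x n} {seq y m} {seq y n}
         (f m n (ℕ.m⊔n≤o⇒m≤o M N m≥) (ℕ.m⊔n≤o⇒m≤o M N n≥))
         (g m n (ℕ.m⊔n≤o⇒n≤o M N m≥) (ℕ.m⊔n≤o⇒n≤o M N n≥)))

_+_ : ℝ → ℝ → ℝ
x + y = real (λ n → seq x n ℚ.+ seq y n) (+-cauchy x y)

abstract
  neg-cauchy : ∀ x → IsCauchy (λ n → ℚ.- seq x n)
  neg-cauchy x ε 0<ε =
    let N , f = cauchy x ε 0<ε
    in N , λ m n m≥ n≥ → near-neg {seq x m} {seq x n} (f m n m≥ n≥)

-_ : ℝ → ℝ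
- x = real (λ n → ℚ.- seq x n) (neg-cauchy x)

private
  product-tolerance : ∀ {B C ε} → 0ℚ ℚ.< B → 0ℚ ℚ.< C → 0ℚ ℚ.< ε →
    ∃[ δ ] ∃[ η ] 0ℚ ℚ.< δ × 0ℚ ℚ.< η × B ℚ.* δ ℚ.+ C ℚ.* η ≡ ε
  product-tolerance {B} {C} {ε} 0<B 0<C 0<ε =
    let δ , 0<δ , eq₁ = shrink B 0<B (half 0<ε)
        η , 0<η , eq₂ = shrink C 0<C (half 0<ε)
    in δ , η , 0<δ , 0<η , trans (cong₂ ℚ._+_ eq₁ eq₂) (½+½ ε)

abstract
  *-cauchy : ∀ x y → IsCauchy (λ n → seq x n ℚ.* seq y n)
  *-cauchy x y ε 0<ε =
    let B , 0<B , K , b = eventually-bounded x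
        C , 0<C , L , c = eventually-bounded y
        δ , η , 0<δ , 0<η , eq = product-tolerance 0<B 0<C 0<ε
        M , f = cauchy x η 0<η
        N , g = cauchy y δ 0<δ
        R = (K ℕ.⊔ L) ℕ.⊔ (M ℕ.⊔ N)
    in R , λ m n m≥ n≥ →
       let mKL = ℕ.m⊔n≤o⇒m≤o (K ℕ.⊔ L) (M ℕ.⊔ N) m≥
           mMN = ℕ.m⊔n≤o⇒n≤o (K ℕ.⊔ L) (M ℕ.⊔ N) m≥
           nKL = ℕ.m⊔n≤o⇒m≤o (K ℕ.⊔ L) (M ℕ.⊔ N) n≥
           nMN = ℕ.m⊔n≤o⇒n≤o (K ℕ.⊔ L) (M ℕ.⊔ N) n≥
       in subst (_ ℚ.≤_) eq
            (near-* {seq x m} {seq x n} {seq y m} {seq y n}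
            (b m (ℕ.m⊔n≤o⇒m≤o K L mKL)) (c n (ℕ.m⊔n≤o⇒n≤o K L nKL))
            (f m n (ℕ.m⊔n≤o⇒m≤o M N mMN) (ℕ.m⊔n≤o⇒m≤o M N nMN))
            (g m n (ℕ.m⊔n≤o⇒n≤o M N mMN) (ℕ.m⊔n≤o⇒n≤o M N nMN)))

_*_ : ℝ → ℝ → ℝ
x * y = real (λ n → seq x n ℚ.* seq y n) (*-cauchy x y)

+-cong : ∀ {x y u v} → x ≈ y → u ≈ v → x + u ≈ y + v
+-cong {x} {y} {u} {v} h k = ≈-intro λ ε 0<ε →
  let M , f = ≈-elim h (½ ℚ.* ε) (half 0<ε)
      N , g = ≈-elim k (½ ℚ.* ε) (half 0<ε)
  in M ℕ.⊔ N , λ n n≥ →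
     subst (_ ℚ.≤_) (½+½ ε)
       (near-+ {seq x n} {seq y n} {seq u n} {seq v n}
       (f n (ℕ.m⊔n≤o⇒m≤o M N n≥)) (g n (ℕ.m⊔n≤o⇒n≤o M N n≥)))

-‿cong : ∀ {x y} → x ≈ y → - x ≈ - y
-‿cong {x} {y} h = ≈-intro λ ε 0<ε → let N , f = ≈-elim h ε 0<ε in N , λ n n≥ →
  near-neg {seq x n} {seq y n} (f n n≥)

*-cong : ∀ {x y u v} → x ≈ y → u ≈ v → x * u ≈ y * v
*-cong {x} {y} {u} {v} h k = ≈-intro λ ε 0<ε →
  let B , 0<B , K , b = eventually-bounded x
      C , 0<C , L , c = eventually-bounded v
      δ , η , 0<δ , 0<η , eq = product-tolerance 0<B 0<C 0<ε
      M , f = ≈-elim h η 0<η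
      N , g = ≈-elim k δ 0<δ
  in (K ℕ.⊔ L) ℕ.⊔ (M ℕ.⊔ N) , λ n n≥ →
     let nKL = ℕ.m⊔n≤o⇒m≤o (K ℕ.⊔ L) (M ℕ.⊔ N) n≥
         nMN = ℕ.m⊔n≤o⇒n≤o (K ℕ.⊔ L) (M ℕ.⊔ N) n≥
     in subst (_ ℚ.≤_) eq
          (near-* {seq x n} {seq y n} {seq u n} {seq v n}
          (b n (ℕ.m⊔n≤o⇒m≤o K L nKL)) (c n (ℕ.m⊔n≤o⇒n≤o K L nKL))
          (f n (ℕ.m⊔n≤o⇒m≤o M N nMN)) (g n (ℕ.m⊔n≤o⇒n≤o M N nMN)))

ℝ-isEquivalence : IsEquivalence _≈_
ℝ-isEquivalence = record { refl = ≈-refl ; sym = ≈-sym ; trans = ≈-trans }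

+-assoc : ∀ x y z → (x + y) + z ≈ x + (y + z)
+-assoc x y z = ≗⇒≈ λ n → ℚ.+-assoc (seq x n) (seq y n) (seq z n)

+-comm : ∀ x y → x + y ≈ y + x
+-comm x y = ≗⇒≈ λ n → ℚ.+-comm (seq x n) (seq y n)

+-identityˡ : ∀ x → 0ℝ + x ≈ x
+-identityˡ x = ≗⇒≈ λ n → ℚ.+-identityˡ (seq x n)

+-identityʳ : ∀ x → x + 0ℝ ≈ x
+-identityʳ x = ≗⇒≈ λ n → ℚ.+-identityʳ (seq x n)

+-inverseˡ : ∀ x → - x + x ≈ 0ℝ
+-inverseˡ x = ≗⇒≈ λ n → ℚ.+-inverseˡ (seq x n)

+-inverseʳ : ∀ x → x + - x ≈ 0ℝ
+-inverseʳ x = ≗⇒≈ λ n → ℚ.+-inverseʳ (seq x n)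

*-assoc : ∀ x y z → (x * y) * z ≈ x * (y * z)
*-assoc x y z = ≗⇒≈ λ n → ℚ.*-assoc (seq x n) (seq y n) (seq z n)

*-comm : ∀ x y → x * y ≈ y * x
*-comm x y = ≗⇒≈ λ n → ℚ.*-comm (seq x n) (seq y n)

*-identityˡ : ∀ x → 1ℝ * x ≈ x
*-identityˡ x = ≗⇒≈ λ n → ℚ.*-identityˡ (seq x n)

*-identityʳ : ∀ x → x * 1ℝ ≈ x
*-identityʳ x = ≗⇒≈ λ n → ℚ.*-identityʳ (seq x n)

*-distribˡ-+ : ∀ x y z → x * (y + z) ≈ x * y + x * z
*-distribˡ-+ x y z = ≗⇒≈ λ n → ℚ.*-distribˡ-+ (seq x n) (seq y n) (seq z n)

*-distribʳ-+ : ∀ x y z → (y + z) * x ≈ y * x + z * x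
*-distribʳ-+ x y z = ≗⇒≈ λ n → ℚ.*-distribʳ-+ (seq x n) (seq y n) (seq z n)

ℝ-commutativeRing : CommutativeRing 0ℓ 0ℓ
ℝ-commutativeRing = record
  { Carrier = ℝ ; _≈_ = _≈_ ; _+_ = _+_ ; _*_ = _*_ ; -_ = -_
  ; 0# = 0ℝ ; 1# = 1ℝ
  ; isCommutativeRing = record
    { isRing = record
      { +-isAbelianGroup = record
        { isGroup = record
          { isMonoid = record
            { isSemigroup = record
              { isMagma = record
                { isEquivalence = ℝ-isEquivalence ; ∙-cong = +-cong }
              ; assoc = +-assoc
              }
            ; identity = +-identityˡ , +-identityʳ
            }
          ; inverse = +-inverseˡ , +-inverseʳ
          ; ⁻¹-cong = -‿cong
          }
        ; comm = +-comm
        }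
      ; *-cong = *-cong
      ; *-assoc = *-assoc
      ; *-identity = *-identityˡ , *-identityʳ
      ; distrib = *-distribˡ-+ , *-distribʳ-+
      }
    ; *-comm = *-comm
    }
  }

-- The square root of max(x, 0), approximated at stage n by the largest
-- multiple s of 1/(n+1) with s² ≤ max(xₙ, 0).

private
  rootAt : ∀ x n → _
  rootAt x n = root (seq x n ℚ.⊔ 0ℚ) (ℚ.p≤q⊔p (seq x n) 0ℚ) n

  √seq : ℝ → ℕ → ℚ
  √seq x n = proj₁ (rootAt x n)

  √-near : ∀ x y m n {ε} → 0ℚ ℚ.≤ ε → 1/1+ n ℚ.≤ ε →
           seq x m ℚ.≤ seq y n ℚ.+ ε ℚ.* ε →
           √seq x m ℚ.≤ √seq y n ℚ.+ (ε ℚ.+ ε)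
  √-near x y m n {ε} 0≤ε δ≤ε h =
    let _ , 0≤s , s²≤ , _ = rootAt x m
        t , 0≤t , _ , ≤t² = rootAt y n
        c = t ℚ.+ 1/1+ n
    in ℚ.≤-trans
         (root-mono (0≤+ 0≤t (ℚ.<⇒≤ (0<1/1+ n))) 0≤ε s²≤ ≤t² (⊔0-≤ {seq x m} {seq y n} (0≤* 0≤ε 0≤ε) h))
         (ℚ.≤-trans (ℚ.+-monoˡ-≤ ε (ℚ.+-monoʳ-≤ t δ≤ε))
           (ℚ.≤-reflexive (ℚ.+-assoc t ε ε)))

abstract
  √-cauchy : ∀ x → IsCauchy (√seq x)
  √-cauchy x ε 0<ε =
    let η     = ½ ℚ.* ε
        0<η   = half 0<ε
        0≤η   = ℚ.<⇒≤ 0<η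
        M , f = cauchy x (η ℚ.* η) (0<* 0<η 0<η)
        N , g = archimedean 0<η
    in M ℕ.⊔ N , λ m n m≥ n≥ →
       let d = f m n (ℕ.m⊔n≤o⇒m≤o M N m≥) (ℕ.m⊔n≤o⇒m≤o M N n≥)
       in ≤⇒near
            (subst (λ e → √seq x m ℚ.≤ √seq x n ℚ.+ e) (½+½ ε)
              (√-near x x m n 0≤η (g (ℕ.m⊔n≤o⇒n≤o M N n≥)) (near⇒≤ {seq x m} {seq x n} d)))
            (subst (λ e → √seq x n ℚ.≤ √seq x m ℚ.+ e) (½+½ ε)
              (√-near x x n m 0≤η (g (ℕ.m⊔n≤o⇒n≤o M N m≥)) (near⇒≥ {seq x m} {seq x n} d)))

√_ : ℝ → ℝ
√ x = real (√seq x) (√-cauchy x)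

√-cong : ∀ {x y} → x ≈ y → √ x ≈ √ y
√-cong {x} {y} h = ≈-intro λ ε 0<ε →
  let η     = ½ ℚ.* ε
      0<η   = half 0<ε
      0≤η   = ℚ.<⇒≤ 0<η
      M , f = ≈-elim h (η ℚ.* η) (0<* 0<η 0<η)
      N , g = archimedean 0<η
  in M ℕ.⊔ N , λ n n≥ →
     let d = f n (ℕ.m⊔n≤o⇒m≤o M N n≥)
         e = g (ℕ.m⊔n≤o⇒n≤o M N n≥)
     in ≤⇒near
          (subst (λ e → √seq x n ℚ.≤ √seq y n ℚ.+ e) (½+½ ε)
            (√-near x y n n 0≤η e (near⇒≤ {seq x n} {seq y n} d)))
          (subst (λ e → √seq y n ℚ.≤ √seq x n ℚ.+ e) (½+½ ε)
            (√-near y x n n 0≤η e (near⇒≥ {seq x n} {seq y n} d)))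

√-nonNeg : ∀ x → 0ℝ ≤ √ x
√-nonNeg x = ≤-intro λ ε 0<ε → 0 , λ n _ →
  0≤+ (proj₁ (proj₂ (rootAt x n))) (ℚ.<⇒≤ 0<ε)

√-square : ∀ {x} → 0ℝ ≤ x → √ x * √ x ≈ x
√-square {x} 0≤x = ≈-intro λ ε 0<ε →
  let B , 0<B , K , b = eventually-bounded (√ x)
      C               = (B ℚ.+ B) ℚ.+ 1ℚ
      0<C             = ℚ.+-mono-< (ℚ.+-mono-< 0<B 0<B) 0<1
      δ , 0<δ , Cδ≡ε  = shrink C 0<C 0<ε
      L , l           = archimedean 0<δ
      O , o           = archimedean 0<1
      M , f           = ≤-elim 0≤x ε 0<ε
  in (K ℕ.⊔ L) ℕ.⊔ (M ℕ.⊔ O) , λ n n≥ →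
     let nKL = ℕ.m⊔n≤o⇒m≤o (K ℕ.⊔ L) (M ℕ.⊔ O) n≥
         nMO = ℕ.m⊔n≤o⇒n≤o (K ℕ.⊔ L) (M ℕ.⊔ O) n≥
         s , 0≤s , s²≤ , ≤s² = rootAt x n
         d    = 1/1+ n
         0≤d  = ℚ.<⇒≤ (0<1/1+ n)
         s≤B  = ℚ.≤-trans (p≤∣p∣ s) (b n (ℕ.m⊔n≤o⇒m≤o K L nKL))
         d≤δ  = l (ℕ.m⊔n≤o⇒n≤o K L nKL)
         d≤1  = o (ℕ.m⊔n≤o⇒n≤o M O nMO)
         max≤ = ℚ.⊔-lub {seq x n ℚ.+ ε} {seq x n} {0ℚ}
                  (≤-by {seq x n} ε (ℚ.<⇒≤ 0<ε) refl)
                  (f n (ℕ.m⊔n≤o⇒m≤o M O nMO))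
         Cd   = *-mono (0≤+ (0≤+ 0≤s 0≤s) 0≤d) (ℚ.<⇒≤ 0<δ)
                  (ℚ.+-mono-≤ (ℚ.+-mono-≤ s≤B s≤B) d≤1) d≤δ
     in ≤⇒near
          (ℚ.≤-trans s²≤ max≤)
          (ℚ.≤-trans (ℚ.p≤p⊔q (seq x n) 0ℚ) (ℚ.≤-trans ≤s²
            (subst (ℚ._≤ s ℚ.* s ℚ.+ ε) (sym (expand s d))
              (ℚ.+-monoʳ-≤ (s ℚ.* s)
                (ℚ.≤-trans Cd (ℚ.≤-reflexive Cδ≡ε))))))
  where
  open +-*-Solver
  expand : ∀ s d → (s ℚ.+ d) ℚ.* (s ℚ.+ d) ≡
                   s ℚ.* s ℚ.+ ((s ℚ.+ s) ℚ.+ d) ℚ.* d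
  expand = solve 2 (λ s d → (s :+ d) :* (s :+ d) :=
                            s :* s :+ ((s :+ s) :+ d) :* d) refl

------------------------------------------------------------------------
-- Real inner-product spaces

record InnerProductSpace (a b : Level) : Set (lsuc (a ⊔ b)) where
  field
    vectorSpace : Module ℝ-commutativeRing a b

  open Module vectorSpace public
    renaming (Carrierᴹ to Carrier)

  field
    ⟨_,_⟩       : Carrier → Carrier → ℝ
    ⟨⟩-cong     : ∀ {u u′ v v′} → u ≈ᴹ u′ → v ≈ᴹ v′ → ⟨ u , v ⟩ ≈ ⟨ u′ , v′ ⟩
    ⟨⟩-comm     : ∀ u v → ⟨ u , v ⟩ ≈ ⟨ v , u ⟩
    ⟨⟩-+        : ∀ u v w → ⟨ u +ᴹ v , w ⟩ ≈ ⟨ u , w ⟩ + ⟨ v , w ⟩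
    ⟨⟩-*        : ∀ c u v → ⟨ c *ₗ u , v ⟩ ≈ c * ⟨ u , v ⟩
    ⟨⟩-nonNeg   : ∀ v → 0ℝ ≤ ⟨ v , v ⟩
    ⟨⟩-definite : ∀ v → ⟨ v , v ⟩ ≈ 0ℝ → v ≈ᴹ 0ᴹ

  infixl 6 _-ᴹ_
  _-ᴹ_ : Carrier → Carrier → Carrier
  u -ᴹ v = u +ᴹ (-ᴹ v)

  ‖_‖ : Carrier → ℝ
  ‖ v ‖ = √ ⟨ v , v ⟩

  open MonoidSum +ᴹ-monoid using (sum)

  lincomb : ∀ {k} → Vector ℝ k → Vector Carrier k → Carrier
  lincomb c e = sum (λ i → c i *ₗ e i)

  IsBasis : ∀ {k} → Vector Carrier k → Set (a ⊔ b)
  IsBasis e = (∀ c → lincomb c e ≈ᴹ 0ᴹ → ∀ i → c i ≈ 0ℝ)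
            × (∀ v → ∃[ c ] v ≈ᴹ lincomb c e)

  HasDimension : ℕ → Set (a ⊔ b)
  HasDimension d = ∃[ e ] IsBasis {d} e

record Lattice {a b} (V : InnerProductSpace a b) (p : Level) :
               Set (a ⊔ b ⊔ lsuc p) where
  open InnerProductSpace V
  field
    points    : Pred Carrier p
    ∈-resp-≈ᴹ : ∀ {u v} → u ≈ᴹ v → u ∈ points → v ∈ points
    0∈        : 0ᴹ ∈ points
    +∈        : ∀ {u v} → u ∈ points → v ∈ points → u +ᴹ v ∈ points
    -∈        : ∀ {u} → u ∈ points → -ᴹ u ∈ points
    discrete  : ∀ {u} → u ∈ points →
                ∃[ ε ] 0ℝ < ε × (∀ {v} → v ∈ points → ‖ v -ᴹ u ‖ < ε → v ≈ᴹ u)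
    spanning  : ∀ v → ∃[ k ] ∃[ c ] ∃[ e ]
                (∀ i → e i ∈ points) × v ≈ᴹ lincomb {k} c e

------------------------------------------------------------------------
-- Minima and cardinalities of sets of real numbers
--
-- Without excluded middle neither a minimum of a set of reals nor its
-- number of elements up to ≈ can be computed, so both are relations. The
-- lemmas below show that each holds of at most one value.

IsMinimum : ∀ {s} → Pred ℝ s → Pred ℝ s
IsMinimum S d = d ∈ S × (∀ x → x ∈ S → d ≤ x)

HasCardinality : ∀ {s} → Pred ℝ s → Pred ℕ s
HasCardinality S k = ∃[ f ] Injective {A = Fin k} _≡_ _≈_ f
                          × (∀ i → f i ∈ S)
                          × (∀ x → x ∈ S → ∃[ i ] x ≈ f i)

minimum-unique : ∀ {s} {S : Pred ℝ s} {x y} →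
                 IsMinimum S x → IsMinimum S y → x ≈ y
minimum-unique {x = x} {y} (x∈S , x≤) (y∈S , y≤) =
  ≤-antisym (x≤ y y∈S) (y≤ x x∈S)

cardinality-unique : ∀ {s} {S : Pred ℝ s} {k l} →
                     HasCardinality S k → HasCardinality S l → k ≡ l
cardinality-unique hk hl = ℕ.≤-antisym (compare hk hl) (compare hl hk)
  where
  compare : ∀ {s} {S : Pred ℝ s} {k l} →
            HasCardinality S k → HasCardinality S l → k ℕ.≤ l
  compare (f , f-inj , f∈S , _) (g , _ , _ , cover) =
    injective⇒≤ {f = λ i → proj₁ (cover (f i) (f∈S i))} λ {i} {j} eq →
      f-inj (≈-trans (proj₂ (cover (f i) (f∈S i)))
        (subst (λ h → g h ≈ f j) (sym eq)
          (≈-sym (proj₂ (cover (f j) (f∈S j))))))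

private
  ¬¬-LEM : ∀ {a r} (A : Set a) {R : Set r} → (A → ¬ R) → (¬ A → ¬ R) → ¬ R
  ¬¬-LEM A yes′ no′ r = no′ (λ a → yes′ a r) r

cardinality-exists : ∀ {s} (S : ℕ → Pred ℝ s) →
  (∀ n {x y} → x ∈ S n → y ∈ S n → x ≈ y) → ∀ N →
  ¬ ¬ ∃ (HasCardinality (λ x → ∃[ n ] (1 ℕ.≤ n × n ℕ.≤ N) × x ∈ S n))
cardinality-exists S unique zero r = r
  (0 , (λ ()) , (λ { {()} }) , (λ ()) ,
   λ { _ (_ , (1≤n , n≤0) , _) → ⊥-elim (ℕ.<⇒≱ 1≤n n≤0) })
cardinality-exists S unique (suc N) r =
  cardinality-exists S unique N λ (k , f , f-inj , f∈ , cover) →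
  let
    T = λ x → ∃[ n ] (1 ℕ.≤ n × n ℕ.≤ suc N) × x ∈ S n

    f∈T : ∀ i → T (f i)
    f∈T i = let n , (1≤n , n≤N) , h = f∈ i in
      n , (1≤n , ℕ.m≤n⇒m≤1+n n≤N) , h

    -- what remains is to cover the elements of S (suc N)
    extend : ∀ {l} (g : Fin l → ℝ) →
             (∀ i → ∃[ j ] f i ≈ g j) →
             (∀ x → x ∈ S (suc N) → ∃[ j ] x ≈ g j) →
             ∀ x → T x → ∃[ j ] x ≈ g j
    extend g f⊆g last x (n , (1≤n , n≤1+N) , h) =
      case ℕ.m≤n⇒m<n∨m≡n n≤1+N of λ where
        (inj₁ n<1+N) →
          let i , x≈fi = cover x (n , (1≤n , ℕ.≤-pred n<1+N) , h)
              j , fi≈gj = f⊆g i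
          in j , ≈-trans x≈fi fi≈gj
        (inj₂ refl) → last x h
  in
  ¬¬-LEM (∃[ x ] x ∈ S (suc N))
    (λ (x , x∈) → ¬¬-LEM (∃[ i ] x ≈ f i)
      (λ (i , x≈fi) r → r (k , f , f-inj , f∈T ,
        extend f (λ i → i , ≈-refl)
          λ y y∈ → i , ≈-trans (unique (suc N) y∈ x∈) x≈fi))
      (λ x∉f r → r (suc k , x ∷ f ,
        (λ { {zero}  {zero}  _ → refl
           ; {zero}  {suc j} h → ⊥-elim (x∉f (j , h))
           ; {suc i} {zero}  h → ⊥-elim (x∉f (i , ≈-sym h))
           ; {suc i} {suc j} h → cong suc (f-inj h) }) ,
        (λ { zero    → suc N , (ℕ.s≤s ℕ.z≤n , ℕ.≤-refl) , x∈
           ; (suc i) → f∈T i }) ,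
        extend (x ∷ f) (λ i → suc i , ≈-refl)
          λ y y∈ → zero , unique (suc N) y∈ x∈)))
    (λ none r → r (k , f , f-inj , f∈T ,
      extend f (λ i → i , ≈-refl) λ y y∈ → ⊥-elim (none (y , y∈))))
    r

------------------------------------------------------------------------
-- Gaps

module _ {a b p} (V : InnerProductSpace a b) (ℒ : Lattice V p) where
  open InnerProductSpace V
  open Lattice ℒ

  Distances : (α : Carrier) (n N : ℕ) → Pred ℝ (a ⊔ b ⊔ p)
  Distances α n N x =
    ∃[ m ] ∃[ ℓ ] (1 ℕ.≤ m × m ℕ.≤ N) × ℓ ∈ points
      × ¬ (fromℤ (m ⊖ n) *ₗ α +ᴹ ℓ ≈ᴹ 0ᴹ)
      × x ≈ ‖ fromℤ (m ⊖ n) *ₗ α +ᴹ ℓ ‖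

  IsGap : (α : Carrier) (n N : ℕ) → Pred ℝ (a ⊔ b ⊔ p)
  IsGap α n N = IsMinimum (Distances α n N)

  Gaps : (α : Carrier) (N : ℕ) → Pred ℝ (a ⊔ b ⊔ p)
  Gaps α N δ = ∃[ n ] (1 ℕ.≤ n × n ℕ.≤ N) × IsGap α n N δ

  IsGapCount : (α : Carrier) (N : ℕ) → Pred ℕ (a ⊔ b ⊔ p)
  IsGapCount α N = HasCardinality (Gaps α N)

  -- Hence quantifying over all g with IsGapCount α N g is not vacuous.
  gapCount-exists : ∀ α N → ¬ ¬ ∃ (IsGapCount α N)
  gapCount-exists α N =
    cardinality-exists (λ n → IsGap α n N) (λ _ → minimum-unique) N

{-# OPTIONS --safe #-}
module Submission where

-- Let Λ be the set of pairs (k , v) with v ∈ kα + ℒ. As |-v| = |v|, the gap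
-- δₙ is the least norm of a nonzero v with (k , v) ∈ Λ and |k| ≤ t, where
-- t = max(n - 1, N - n). All these t lie in [T , 2T], T being the least of
-- them, so every gap other than the first is attained by some (qᵢ , vᵢ) with
-- T < qᵢ ≤ 2T, and vᵢ gets shorter as qᵢ grows. In Λ/2Λ the classes of these
-- points are nonzero and distinct, since otherwise half a sum or difference
-- would be short at level ≤ T. They are also sum-free: three points adding up
-- to 0 mod 2 have half-sums A, B, C with A + B, A + C, B + C the three points,
-- and |A+B|² + |A+C|² + |B+C|² = |A|² + |B|² + |C|² + |A+B+C|² is impossible.
-- A sum-free subset of Λ/2Λ, which has at most 2^(d+1) elements, has at most
-- 2^d elements.

open import Defs
open import Data.Nat.Base using (ℕ) renaming (_≤_ to _≤ℕ_)
open import Data.Nat.Base as ℕ using (zero; suc; _^_)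
open import Algebra.Bundles using (AbelianGroup; CommutativeRing)
import Algebra.Construct.DirectProduct as DirectProduct
import Algebra.Properties.AbelianGroup as GroupProperties
import Algebra.Properties.CommutativeSemigroup as CommutativeSemigroupProperties
open import Data.Empty using (⊥-elim)
open import Data.Fin.Base using (Fin; zero; suc; toℕ; fromℕ; inject₁; punchIn; splitAt; join; remQuot; combine; funToFin; finToFun)
open import Data.Fin.Properties using (_≟_; <⇒≢; pigeonhole; toℕ-fromℕ; toℕ-inject₁; punchInᵢ≢i; punchIn-injective; join-splitAt; combine-remQuot; finToFun-funToFin)
open import Data.Integer.Base as ℤ using (ℤ; +_; -[1+_]; _⊖_)
import Data.Integer.Properties as ℤ
import Data.Integer.Tactic.RingSolver as ℤ-Solver
import Data.Nat.Coprimality as Coprime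
import Data.Nat.Properties as ℕ
import Data.Nat.Tactic.RingSolver as ℕ-Solver
open import Data.Product.Base using (∃-syntax; _×_; _,_; proj₁; proj₂)
open import Data.Rational.Base as ℚ using (ℚ; 0ℚ; 1ℚ; ½)
import Data.Rational.Properties as ℚ
open import Data.Rational.Solver using (module +-*-Solver)
import Data.Rational.Unnormalised.Base as ℚᵘ
import Data.Rational.Unnormalised.Properties as ℚᵘ
open import Data.Sum.Base using (_⊎_; inj₁; inj₂)
open import Data.Vec.Functional using (Vector; _∷_)
open import Function.Base using (_∘_)
open import Level using (_⊔_)
open import Relation.Binary.PropositionalEquality.Core using (_≡_; _≢_; ≢-sym; refl; sym; trans; cong; cong₂; subst; subst₂)
import Relation.Binary.Reasoning.Setoid as ≈-Reasoning
open import Relation.Nullary.Decidable.Core using (yes; no)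
open import Relation.Nullary.Negation.Core using (¬_)
open import Relation.Unary using (_∈_)

open ℚ-Lemmas
open +-*-Solver using (solve; _:=_; _:+_; _:*_; _:-_; :-_; con)

-- Real numbers

≈⇒≤ : ∀ {x y} → x ≈ y → x ≤ y
≈⇒≤ {x} {y} x≈y = ≤-intro λ ε 0<ε →
  let N , f = ≈-elim x≈y ε 0<ε
  in N , λ n N≤n → near⇒≤ {seq x n} {seq y n} (f n N≤n)

≤-refl : ∀ {x} → x ≤ x
≤-refl = ≈⇒≤ ≈-refl

≤-trans : ∀ {x y z} → x ≤ y → y ≤ z → x ≤ z
≤-trans {x} {y} {z} x≤y y≤z = ≤-intro λ ε 0<ε →
  let M , f = ≤-elim x≤y (½ ℚ.* ε) (half 0<ε)
      N , g = ≤-elim y≤z (½ ℚ.* ε) (half 0<ε)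
  in M ℕ.⊔ N , λ n n≥ → ℚ.≤-trans (f n (ℕ.m⊔n≤o⇒m≤o M N n≥))
       (ℚ.≤-trans (ℚ.+-monoˡ-≤ (½ ℚ.* ε) (g n (ℕ.m⊔n≤o⇒n≤o M N n≥)))
         (ℚ.≤-reflexive (trans (ℚ.+-assoc (seq z n) _ _) (cong (seq z n ℚ.+_) (½+½ ε)))))

≤-resp-≈ : ∀ {x x′ y y′} → x ≈ x′ → y ≈ y′ → x ≤ y → x′ ≤ y′
≤-resp-≈ x≈x′ y≈y′ x≤y = ≤-trans (≈⇒≤ (≈-sym x≈x′)) (≤-trans x≤y (≈⇒≤ y≈y′))

+-mono-≤ : ∀ {x y u v} → x ≤ y → u ≤ v → x + u ≤ y + v
+-mono-≤ {x} {y} {u} {v} x≤y u≤v = ≤-intro λ ε 0<ε →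
  let M , f = ≤-elim x≤y (½ ℚ.* ε) (half 0<ε)
      N , g = ≤-elim u≤v (½ ℚ.* ε) (half 0<ε)
  in M ℕ.⊔ N , λ n n≥ → ℚ.≤-trans
       (ℚ.+-mono-≤ (f n (ℕ.m⊔n≤o⇒m≤o M N n≥)) (g n (ℕ.m⊔n≤o⇒n≤o M N n≥)))
       (ℚ.≤-reflexive (trans (shuffle (seq y n) (seq v n) (½ ℚ.* ε))
         (cong (seq y n ℚ.+ seq v n ℚ.+_) (½+½ ε))))
  where
  shuffle : ∀ p q e → (p ℚ.+ e) ℚ.+ (q ℚ.+ e) ≡ (p ℚ.+ q) ℚ.+ (e ℚ.+ e)
  shuffle = solve 3 (λ p q e → (p :+ e) :+ (q :+ e) := (p :+ q) :+ (e :+ e)) refl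

+-cancelʳ-≤ : ∀ z {x y} → x + z ≤ y + z → x ≤ y
+-cancelʳ-≤ z {x} {y} h = ≤-resp-≈ (cancel x) (cancel y) (+-mono-≤ h (≤-refl { - z}))
  where
  cancel : ∀ w → w + z + - z ≈ w
  cancel w = ≗⇒≈ λ n →
    solve 2 (λ w z → w :+ z :+ :- z := w) refl (seq w n) (seq z n)

x≤x+y : ∀ {x y} → 0ℝ ≤ y → x ≤ x + y
x≤x+y {x} 0≤y = ≤-resp-≈ (+-identityʳ x) ≈-refl (+-mono-≤ ≤-refl 0≤y)

0≤x+y : ∀ {x y} → 0ℝ ≤ x → 0ℝ ≤ y → 0ℝ ≤ x + y
0≤x+y 0≤x 0≤y = ≤-resp-≈ (+-identityˡ 0ℝ) ≈-refl (+-mono-≤ 0≤x 0≤y)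

0≤p*p : ∀ p → 0ℚ ℚ.≤ p ℚ.* p
0≤p*p p with ℚ.≤-total 0ℚ p
... | inj₁ 0≤p = 0≤* 0≤p 0≤p
... | inj₂ p≤0 = subst (0ℚ ℚ.≤_)
  (solve 1 (λ p → (:- p) :* (:- p) := p :* p) refl p)
  (0≤* (ℚ.neg-antimono-≤ p≤0) (ℚ.neg-antimono-≤ p≤0))

-- x * y is the square of √ x * √ y, and squares are pointwise nonnegative.
*-nonNeg : ∀ {x y} → 0ℝ ≤ x → 0ℝ ≤ y → 0ℝ ≤ x * y
*-nonNeg {x} {y} 0≤x 0≤y = ≤-resp-≈ ≈-refl
  (≈-trans interchange (*-cong (√-square 0≤x) (√-square 0≤y)))
  (≤-intro {0ℝ} {√ x * √ y * (√ x * √ y)} λ ε 0<ε →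
    0 , λ n _ → 0≤+ (0≤p*p (seq (√ x * √ y) n)) (ℚ.<⇒≤ 0<ε))
  where
  interchange : √ x * √ y * (√ x * √ y) ≈ √ x * √ x * (√ y * √ y)
  interchange = ≗⇒≈ λ n →
    solve 2 (λ p q → p :* q :* (p :* q) := p :* p :* (q :* q)) refl
      (seq (√ x) n) (seq (√ y) n)

-- √ y * √ y ≥ √ x * √ x because (√ y - √ x) * (√ y + √ x) ≥ 0.
√-cancel-≤ : ∀ {x y} → 0ℝ ≤ x → 0ℝ ≤ y → √ x ≤ √ y → x ≤ y
√-cancel-≤ {x} {y} 0≤x 0≤y √x≤√y = ≤-resp-≈
  (≈-trans (+-identityˡ _) (√-square 0≤x))
  (≈-trans factor (√-square 0≤y))
  (+-mono-≤
    (*-nonNeg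
      (≤-resp-≈ (+-inverseʳ (√ x)) ≈-refl (+-mono-≤ √x≤√y (≤-refl { - √ x})))
      (0≤x+y (√-nonNeg y) (√-nonNeg x)))
    (≤-refl {√ x * √ x}))
  where
  factor : (√ y + - √ x) * (√ y + √ x) + √ x * √ x ≈ √ y * √ y
  factor = ≗⇒≈ λ n →
    solve 2 (λ p q → (q :+ :- p) :* (q :+ p) :+ p :* p := q :* q) refl
      (seq (√ x) n) (seq (√ y) n)

-- Stage n of `√ x` approximates the root of stage n of x from below, so the bound passes to it at
-- the same n and without an error term.
√-upper : ∀ {x n θ} → 0ℚ ℚ.≤ θ → seq x n ℚ.≤ θ ℚ.* θ → seq (√ x) n ℚ.≤ θ
√-upper {x} {n} {θ} 0≤θ xₙ≤θ² =
  let _ , _ , s²≤ , _ = root (seq x n ℚ.⊔ 0ℚ) (ℚ.p≤q⊔p (seq x n) 0ℚ) n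
  in square-cancel-≤ 0≤θ (ℚ.≤-trans s²≤ (ℚ.⊔-lub xₙ≤θ² (0≤* 0≤θ 0≤θ)))

-- Bounds |x| through the terms of its sequence, so that sums and products need only rational
-- estimates. It is not invariant under `≈`.
Bounded : ℚ → ℝ → Set
Bounded r x = ∃[ N ] ∀ n → N ≤ℕ n → ℚ.∣ seq x n ∣ ℚ.≤ r

Bounded-mono : ∀ {r s x} → r ℚ.≤ s → Bounded r x → Bounded s x
Bounded-mono r≤s (N , f) = N , λ n N≤n → ℚ.≤-trans (f n N≤n) r≤s

Bounded-+ : ∀ {r s x y} → Bounded r x → Bounded s y → Bounded (r ℚ.+ s) (x + y)
Bounded-+ {x = x} {y} (M , f) (N , g) = M ℕ.⊔ N , λ n n≥ →
  ℚ.≤-trans (ℚ.∣p+q∣≤∣p∣+∣q∣ (seq x n) (seq y n))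
    (ℚ.+-mono-≤ (f n (ℕ.m⊔n≤o⇒m≤o M N n≥)) (g n (ℕ.m⊔n≤o⇒n≤o M N n≥)))

Bounded-* : ∀ {r s x y} → 0ℚ ℚ.≤ s → Bounded r x → Bounded s y → Bounded (r ℚ.* s) (x * y)
Bounded-* {s = s} {x} {y} 0≤s (M , f) (N , g) = M ℕ.⊔ N , λ n n≥ →
  ℚ.≤-trans (ℚ.≤-reflexive (ℚ.∣p*q∣≡∣p∣*∣q∣ (seq x n) (seq y n)))
    (*-mono (ℚ.0≤∣p∣ (seq x n)) 0≤s
      (f n (ℕ.m⊔n≤o⇒m≤o M N n≥)) (g n (ℕ.m⊔n≤o⇒n≤o M N n≥)))

-- Division of an interval into cells

ι-mono : ∀ {m n} → m ≤ℕ n → ι m ℚ.≤ ι n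
ι-mono {m} {n} m≤n = ℚ.*≤* (ℤ.*-monoʳ-≤-nonNeg (+ 1) (ℤ.+≤+ m≤n))

ι-+ : ∀ m n → ι (m ℕ.+ n) ≡ ι m ℚ.+ ι n
ι-+ zero    n = sym (ℚ.+-identityˡ (ι n))
ι-+ (suc m) n = trans (ι-suc (m ℕ.+ n)) (trans (cong (ℚ._+ 1ℚ) (ι-+ m n))
  (trans (solve 2 (λ p q → p :+ q :+ con 1ℚ := p :+ con 1ℚ :+ q) refl (ι m) (ι n))
    (cong (ℚ._+ ι n) (sym (ι-suc m)))))

-- The cells are tried from the top down. The order of `ℚ` is decidable, so a rational has a
-- computable cell, which a real number need not have.
cell : ∀ {δ} M q → 0ℚ ℚ.≤ q → q ℚ.< ι M ℚ.* δ →
       ∃[ t ] ι (toℕ {M} t) ℚ.* δ ℚ.≤ q × q ℚ.≤ ι (toℕ t) ℚ.* δ ℚ.+ δ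
cell {δ} zero q 0≤q q<0 =
  ⊥-elim (ℚ.<-irrefl refl (ℚ.≤-<-trans 0≤q (subst (q ℚ.<_) (ℚ.*-zeroˡ δ) q<0)))
cell {δ} (suc M) q 0≤q q< with ι M ℚ.* δ ℚ.≤? q
... | yes h = fromℕ M ,
  subst (λ k → ι k ℚ.* δ ℚ.≤ q) (sym (toℕ-fromℕ M)) h ,
  subst (λ k → q ℚ.≤ ι k ℚ.* δ ℚ.+ δ) (sym (toℕ-fromℕ M))
    (ℚ.≤-trans (ℚ.<⇒≤ q<) (ℚ.≤-reflexive (trans (cong (ℚ._* δ) (ι-suc M))
      (solve 2 (λ m d → (m :+ con 1ℚ) :* d := m :* d :+ d) refl (ι M) δ))))
... | no ¬h =
  let t , lower , upper = cell {δ} M q 0≤q (ℚ.≰⇒> ¬h) in inject₁ t ,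
  subst (λ k → ι k ℚ.* δ ℚ.≤ q) (sym (toℕ-inject₁ t)) lower ,
  subst (λ k → q ℚ.≤ ι k ℚ.* δ ℚ.+ δ) (sym (toℕ-inject₁ t)) upper

-- A real number gets the cell of one rational term p of its sequence, taken so late that |p| ≤ B
-- and all later terms stay within δ of p. Adding B moves [-B, B] to [0, B + B]. The cell thus
-- depends on the sequence and on the bound, not only on the number.
module Cells (δ B : ℚ) (0<δ : 0ℚ ℚ.< δ) (M : ℕ) (B+B<Mδ : B ℚ.+ B ℚ.< ι M ℚ.* δ) where

  private
    sample : ∀ x → Bounded B x → ∃[ p ] ℚ.∣ p ∣ ℚ.≤ B ×
             (∃[ N ] ∀ n → N ≤ℕ n → ℚ.∣ seq x n ℚ.- p ∣ ℚ.≤ δ)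
    sample x (L , f) =
      let N , g = cauchy x δ 0<δ
          K     = L ℕ.⊔ N
      in seq x K , f K (ℕ.m≤m⊔n L N) ,
         K , λ n K≤n → g n K (ℕ.≤-trans (ℕ.m≤n⊔m L N) K≤n) (ℕ.m≤n⊔m L N)

    located : ∀ p → ℚ.∣ p ∣ ℚ.≤ B → _
    located p ∣p∣≤B = cell {δ} M (p ℚ.+ B)
      (subst (0ℚ ℚ.≤_) (solve 2 (λ p b → b :- (:- p) := p :+ b) refl p B)
        (0≤diff (ℚ.≤-trans (p≤∣p∣ (ℚ.- p))
          (subst (ℚ._≤ B) (sym (ℚ.∣-p∣≡∣p∣ p)) ∣p∣≤B))))
      (ℚ.≤-<-trans (ℚ.+-monoˡ-≤ B (ℚ.≤-trans (p≤∣p∣ p) ∣p∣≤B)) B+B<Mδ)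

  cellOf : ∀ x → Bounded B x → Fin M
  cellOf x b = let p , ∣p∣≤B , _ = sample x b in proj₁ (located p ∣p∣≤B)

  -- Three errors of δ add up: from x to its sample, between two samples in one cell, and from the
  -- other sample to y.
  cellOf-near : ∀ {x y} b c → cellOf x b ≡ cellOf y c → Bounded (δ ℚ.+ δ ℚ.+ δ) (x + - y)
  cellOf-near {x} {y} b c eq =
    let p , ∣p∣≤B , K , f = sample x b
        q , ∣q∣≤B , L , g = sample y c
        t , p≥ , p≤ = located p ∣p∣≤B
        u , q≥ , q≤ = located q ∣q∣≤B
        t≡u = cong (λ v → ι (toℕ v) ℚ.* δ) eq
        q≥′ = subst (ℚ._≤ q ℚ.+ B) (sym t≡u) q≥
        q≤′ = subst (λ w → q ℚ.+ B ℚ.≤ w ℚ.+ δ) (sym t≡u) q≤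
        cancel : ∀ p q → (p ℚ.+ B) ℚ.- (q ℚ.+ B) ≡ p ℚ.- q
        cancel = λ p q → solve 3 (λ p q b → (p :+ b) :- (q :+ b) := p :- q) refl p q B
        p~q : ℚ.∣ p ℚ.- q ∣ ℚ.≤ δ
        p~q = subst (λ r → ℚ.∣ r ∣ ℚ.≤ δ) (cancel p q)
          (≤⇒near {p ℚ.+ B} {q ℚ.+ B}
            (ℚ.≤-trans p≤ (ℚ.+-monoˡ-≤ δ q≥′))
            (ℚ.≤-trans q≤′ (ℚ.+-monoˡ-≤ δ p≥)))
    in K ℕ.⊔ L , λ n n≥ →
       near-trans {seq x n} {q} {seq y n}
         (near-trans {seq x n} {p} {q} (f n (ℕ.m⊔n≤o⇒m≤o K L n≥)) p~q)
         (subst (ℚ._≤ δ) (∣p-q∣≡∣q-p∣ (seq y n) q) (g n (ℕ.m⊔n≤o⇒n≤o K L n≥)))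

-- Integers among the real numbers

fromℤ-+ : ∀ i j → fromℤ (i ℤ.+ j) ≈ fromℤ i + fromℤ j
fromℤ-+ i j = ≗⇒≈ λ _ → ℚ.toℚᵘ-injective (ℚᵘ.≃-trans
  (ℚ.toℚᵘ-fromℚᵘ (ℚᵘ.mkℚᵘ (i ℤ.+ j) 0))
  (ℚᵘ.≃-trans (ℚᵘ.*≡* (lemma i j))
    (ℚᵘ.≃-sym (ℚᵘ.≃-trans (ℚ.toℚᵘ-homo-+ (i ℚ./ 1) (j ℚ./ 1))
      (ℚᵘ.+-cong (ℚ.toℚᵘ-fromℚᵘ (ℚᵘ.mkℚᵘ i 0)) (ℚ.toℚᵘ-fromℚᵘ (ℚᵘ.mkℚᵘ j 0)))))))
  where
  lemma : ∀ i j → (i ℤ.+ j) ℤ.* + 1 ≡ (i ℤ.* + 1 ℤ.+ j ℤ.* + 1) ℤ.* + 1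
  lemma = ℤ-Solver.solve-∀

open GroupProperties (CommutativeRing.+-abelianGroup ℝ-commutativeRing)
  using () renaming (inverseˡ-unique to +-inverseˡ-unique)

fromℤ-neg : ∀ i → fromℤ (ℤ.- i) ≈ - fromℤ i
fromℤ-neg i = +-inverseˡ-unique (fromℤ (ℤ.- i)) (fromℤ i) (≈-trans
  (≈-sym (fromℤ-+ (ℤ.- i) i))
  (≗⇒≈ λ _ → cong (ℚ._/ 1) (ℤ.+-inverseˡ i)))

+n/1≡ιn : ∀ n → + n ℚ./ 1 ≡ ι n
+n/1≡ιn n = ℚ.normalize-coprime (Coprime.sym (Coprime.1-coprimeTo n))

∣i/1∣≡ι∣i∣ : ∀ i → ℚ.∣ i ℚ./ 1 ∣ ≡ ι ℤ.∣ i ∣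
∣i/1∣≡ι∣i∣ (+ n)    = trans (cong ℚ.∣_∣ (+n/1≡ιn n)) (ℚ.0≤p⇒∣p∣≡p (ι-nonNeg n))
∣i/1∣≡ι∣i∣ -[1+ n ] = trans (ℚ.∣-p∣≡∣p∣ (+ suc n ℚ./ 1)) (∣i/1∣≡ι∣i∣ (+ suc n))

-- At a late stage i is within 1/4 of a term of size at most 1/2, so |i| ≤ 3/4 < 1.
Bounded-½⇒0 : ∀ i {x} → fromℤ i ≈ x → Bounded ½ x → i ≡ + 0
Bounded-½⇒0 i {x} i≈x (M , f) =
  let N , g  = ≈-elim i≈x ¼ (ℚ.positive⁻¹ ¼)
      n      = M ℕ.⊔ N
      near   = near-trans {i ℚ./ 1} {seq x n} {0ℚ} (g n (ℕ.m≤n⊔m M N))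
                 (subst (λ p → ℚ.∣ p ∣ ℚ.≤ ½) (sym (ℚ.+-identityʳ (seq x n))) (f n (ℕ.m≤m⊔n M N)))
  in ℤ.∣i∣≡0⇒i≡0 (small ℤ.∣ i ∣ (subst (ℚ._≤ ¼ ℚ.+ ½)
       (trans (cong ℚ.∣_∣ (ℚ.+-identityʳ (i ℚ./ 1))) (∣i/1∣≡ι∣i∣ i)) near))
  where
  ¼ = ½ ℚ.* ½
  small : ∀ n → ι n ℚ.≤ ¼ ℚ.+ ½ → n ≡ 0
  small zero    _ = refl
  small (suc n) h = ⊥-elim (ℚ.<-irrefl refl (ℚ.<-≤-trans
    {¼ ℚ.+ ½} {1ℚ} (ℚ.*<* (ℤ.+<+ (ℕ.s≤s (ℕ.s≤s (ℕ.s≤s (ℕ.s≤s ℕ.z≤n))))))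
    (ℚ.≤-trans (ι-mono (ℕ.s≤s (ℕ.z≤n {n}))) h)))

Bounded⇒≤ : ∀ {r x} → Bounded r x → x ≤ fromℚ r
Bounded⇒≤ {r} {x} (N , f) = ≤-intro λ ε 0<ε → N , λ n N≤n →
  ℚ.≤-trans (p≤∣p∣ (seq x n)) (ℚ.≤-trans (f n N≤n) (≤-by ε (ℚ.<⇒≤ 0<ε) refl))

fromℚ-mono-≤ : ∀ {p q} → p ℚ.≤ q → fromℚ p ≤ fromℚ q
fromℚ-mono-≤ p≤q = ≤-intro λ ε 0<ε → 0 , λ _ _ → ℚ.≤-trans p≤q (≤-by ε (ℚ.<⇒≤ 0<ε) refl)

positive-lower-bound : ∀ {p q} → 0ℚ ℚ.< p → 0ℚ ℚ.< q →
                       ∃[ r ] 0ℚ ℚ.< r × r ℚ.≤ p × r ℚ.≤ q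
positive-lower-bound {p} {q} 0<p 0<q with ℚ.≤-total p q
... | inj₁ p≤q = p , 0<p , ℚ.≤-refl , p≤q
... | inj₂ q≤p = q , 0<q , q≤p , ℚ.≤-refl

-- Inner-product spaces

module InnerProduct {a b} (V : InnerProductSpace a b) where
  open InnerProductSpace V
  open GroupProperties +ᴹ-abelianGroup using ()
    renaming (⁻¹-∙-comm to -ᴹ-+ᴹ-comm; ε⁻¹≈ε to -0≈0)
  open CommutativeSemigroupProperties (AbelianGroup.commutativeSemigroup +ᴹ-abelianGroup)
    using (interchange)

  sq : Carrier → ℝ
  sq v = ⟨ v , v ⟩

  sq-cong : ∀ {u v} → u ≈ᴹ v → sq u ≈ sq v
  sq-cong u≈v = ⟨⟩-cong u≈v u≈v

  ⟨⟩-+ʳ : ∀ u v w → ⟨ u , v +ᴹ w ⟩ ≈ ⟨ u , v ⟩ + ⟨ u , w ⟩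
  ⟨⟩-+ʳ u v w = ≈-trans (⟨⟩-comm u (v +ᴹ w))
    (≈-trans (⟨⟩-+ v w u) (+-cong (⟨⟩-comm v u) (⟨⟩-comm w u)))

  ⟨⟩-zeroˡ : ∀ v → ⟨ 0ᴹ , v ⟩ ≈ 0ℝ
  ⟨⟩-zeroˡ v = ≈-trans (⟨⟩-cong (≈ᴹ-sym (*ₗ-zeroˡ 0ᴹ)) ≈ᴹ-refl)
    (≈-trans (⟨⟩-* 0ℝ 0ᴹ v) (≗⇒≈ λ n → ℚ.*-zeroˡ (seq ⟨ 0ᴹ , v ⟩ n)))

  ⟨⟩-negˡ : ∀ u v → ⟨ -ᴹ u , v ⟩ ≈ - ⟨ u , v ⟩
  ⟨⟩-negˡ u v = +-inverseˡ-unique ⟨ -ᴹ u , v ⟩ ⟨ u , v ⟩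
    (≈-trans (≈-sym (⟨⟩-+ (-ᴹ u) u v))
      (≈-trans (⟨⟩-cong (-ᴹ‿inverseˡ u) ≈ᴹ-refl) (⟨⟩-zeroˡ v)))

  sq-neg : ∀ v → sq (-ᴹ v) ≈ sq v
  sq-neg v = ≈-trans (⟨⟩-negˡ v (-ᴹ v))
    (≈-trans (-‿cong (≈-trans (⟨⟩-comm v (-ᴹ v)) (⟨⟩-negˡ v v)))
      (≗⇒≈ λ n → solve 1 (λ p → :- (:- p) := p) refl (seq (sq v) n)))

  sq-* : ∀ c v → sq (c *ₗ v) ≈ c * c * sq v
  sq-* c v = ≈-trans (⟨⟩-* c v (c *ₗ v))
    (≈-trans (*-cong (≈-refl {c}) (≈-trans (⟨⟩-comm v (c *ₗ v)) (⟨⟩-* c v v)))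
      (≈-sym (*-assoc c c (sq v))))

  sq-+ : ∀ u v → sq (u +ᴹ v) ≈ sq u + (⟨ u , v ⟩ + ⟨ u , v ⟩) + sq v
  sq-+ u v = ≈-trans (⟨⟩-+ u v (u +ᴹ v))
    (≈-trans (+-cong (⟨⟩-+ʳ u u v) (≈-trans (⟨⟩-+ʳ v u v) (+-cong (⟨⟩-comm v u) (≈-refl {sq v}))))
      (≗⇒≈ λ n → solve 3 (λ x y z → x :+ z :+ (z :+ y) := x :+ (z :+ z) :+ y) refl
        (seq (sq u) n) (seq (sq v) n) (seq ⟨ u , v ⟩ n)))

  -- The parallelogram law for u + w and w. Their sum and difference are u + 2w and u, two vectors
  -- congruent modulo 2.
  parallelogram : ∀ u w → sq (u +ᴹ (w +ᴹ w)) + sq u ≈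
                  (sq (u +ᴹ w) + sq (u +ᴹ w)) + (sq w + sq w)
  parallelogram u w = ≈-trans
    (+-cong (≈-trans (sq-+ u (w +ᴹ w))
      (+-cong (+-cong (≈-refl {sq u}) (+-cong (⟨⟩-+ʳ u w w) (⟨⟩-+ʳ u w w))) (sq-+ w w)))
      (≈-refl {sq u}))
    (≈-trans
      (≗⇒≈ λ n → solve 3 (λ x y z →
          x :+ ((z :+ z) :+ (z :+ z)) :+ (y :+ (y :+ y) :+ y) :+ x
          := ((x :+ (z :+ z) :+ y) :+ (x :+ (z :+ z) :+ y)) :+ (y :+ y)) refl
          (seq (sq u) n) (seq (sq w) n) (seq ⟨ u , w ⟩ n))
      (≈-sym (+-cong (+-cong (sq-+ u w) (sq-+ u w)) (≈-refl {sq w + sq w}))))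

  -- Both sides expand to 2(|u|² + |v|² + |w|²) + 2(⟨u,v⟩ + ⟨u,w⟩ + ⟨v,w⟩).
  pairwise-sums : ∀ u v w →
    sq (u +ᴹ v) + sq (u +ᴹ w) + sq (v +ᴹ w) ≈ sq u + sq v + sq w + sq (u +ᴹ v +ᴹ w)
  pairwise-sums u v w = ≈-trans
    (+-cong (+-cong (sq-+ u v) (sq-+ u w)) (sq-+ v w))
    (≈-trans
      (≗⇒≈ λ n → solve 6 (λ x y z p q r →
          (x :+ (p :+ p) :+ y) :+ (x :+ (q :+ q) :+ z) :+ (y :+ (r :+ r) :+ z)
          := x :+ y :+ z :+ ((x :+ (p :+ p) :+ y) :+ ((q :+ r) :+ (q :+ r)) :+ z)) refl
          (seq (sq u) n) (seq (sq v) n) (seq (sq w) n)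
          (seq ⟨ u , v ⟩ n) (seq ⟨ u , w ⟩ n) (seq ⟨ v , w ⟩ n))
      (+-cong (≈-refl {sq u + sq v + sq w}) (≈-sym (≈-trans (sq-+ (u +ᴹ v) w)
        (+-cong (+-cong (sq-+ u v) (+-cong (⟨⟩-+ u v w) (⟨⟩-+ u v w))) (≈-refl {sq w}))))))

  -- The two sides differ by |u - v|².
  sq-+-≤ : ∀ u v → sq (u +ᴹ v) ≤ (sq u + sq u) + (sq v + sq v)
  sq-+-≤ u v = ≤-resp-≈ ≈-refl
    (≈-trans (+-cong (≈-refl {sq (u +ᴹ v)})
      (≈-trans (sq-+ u (-ᴹ v)) (+-cong (+-cong (≈-refl {sq u}) (+-cong neg neg)) (sq-neg v))))
      rearranged)
    (x≤x+y (⟨⟩-nonNeg (u +ᴹ -ᴹ v)))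
    where
    neg : ⟨ u , -ᴹ v ⟩ ≈ - ⟨ u , v ⟩
    neg = ≈-trans (⟨⟩-comm u (-ᴹ v)) (≈-trans (⟨⟩-negˡ v u) (-‿cong (⟨⟩-comm v u)))
    rearranged : sq (u +ᴹ v) + (sq u + (- ⟨ u , v ⟩ + - ⟨ u , v ⟩) + sq v) ≈
                 (sq u + sq u) + (sq v + sq v)
    rearranged = ≈-trans (+-cong (sq-+ u v) (≈-refl {sq u + (- ⟨ u , v ⟩ + - ⟨ u , v ⟩) + sq v}))
      (≗⇒≈ λ n → solve 3 (λ x y z →
        (x :+ (z :+ z) :+ y) :+ (x :+ (:- z :+ :- z) :+ y) := (x :+ x) :+ (y :+ y)) refl
        (seq (sq u) n) (seq (sq v) n) (seq ⟨ u , v ⟩ n))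

  -- Continuity of `lincomb` at 0, by splitting off one vector at a time with `sq-+-≤`.
  sq-lincomb-small : ∀ {k} (e : Vector Carrier k) {r} → 0ℚ ℚ.< r →
    ∃[ δ ] 0ℚ ℚ.< δ × (∀ c → (∀ i → Bounded δ (c i)) → sq (lincomb c e) ≤ fromℚ r)
  sq-lincomb-small {zero} e {r} 0<r = 1ℚ , 0<1 , λ _ _ →
    ≤-resp-≈ (≈-sym (⟨⟩-zeroˡ 0ᴹ)) ≈-refl (fromℚ-mono-≤ (ℚ.<⇒≤ 0<r))
  sq-lincomb-small {suc k} e {r} 0<r =
    -- `sq-+-≤` doubles both terms, so each of them may be at most r/4.
    let s                    = ½ ℚ.* (½ ℚ.* r)
        0<s                  = half (half 0<r)
        δ₁ , 0<δ₁ , rest     = sq-lincomb-small (e ∘ suc) 0<s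
        B , 0<B , b          = eventually-bounded (sq (e zero))
        δ₂ , 0<δ₂ , Bδ₂≡s    = shrink B 0<B 0<s
        δ₃ , 0<δ₃ , ≤δ₁ , ≤δ₂ = positive-lower-bound 0<δ₁ 0<δ₂
        -- With δ ≤ 1 also δ² ≤ δ ≤ δ₂, hence δ²B ≤ s.
        δ , 0<δ , ≤δ₃ , ≤1   = positive-lower-bound 0<δ₃ 0<1
        0≤δ                  = ℚ.<⇒≤ 0<δ
        0≤B                  = ℚ.<⇒≤ 0<B
        δδB≤s : δ ℚ.* δ ℚ.* B ℚ.≤ s
        δδB≤s = ℚ.≤-trans
          (*-mono {δ ℚ.* δ} {δ₂} {B} {B} (0≤* 0≤δ 0≤δ) 0≤B
            (ℚ.≤-trans (*-mono 0≤δ 0≤1 (ℚ.≤-trans ≤δ₃ ≤δ₂) ≤1) (ℚ.≤-reflexive (ℚ.*-identityʳ δ₂)))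
            ℚ.≤-refl)
          (ℚ.≤-reflexive (trans (ℚ.*-comm δ₂ B) Bδ₂≡s))
    in δ , 0<δ , λ c c-small →
       let u = c zero *ₗ e zero
           v = lincomb (c ∘ suc) (e ∘ suc)
           sq-u≤s = ≤-resp-≈ (≈-sym (sq-* (c zero) (e zero))) ≈-refl
             (≤-trans (Bounded⇒≤ (Bounded-* {x = c zero * c zero} {sq (e zero)} 0≤B
               (Bounded-* {x = c zero} {c zero} 0≤δ (c-small zero) (c-small zero)) b))
               (fromℚ-mono-≤ δδB≤s))
           sq-v≤s = rest (c ∘ suc) λ i →
             Bounded-mono {x = c (suc i)} (ℚ.≤-trans ≤δ₃ ≤δ₁) (c-small (suc i))
       in ≤-trans (sq-+-≤ u v) (≤-resp-≈ ≈-refl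
            (≗⇒≈ λ _ → solve 1 (λ r →
              let s = con ½ :* (con ½ :* r) in (s :+ s) :+ (s :+ s) := r) refl r)
            (+-mono-≤ (+-mono-≤ sq-u≤s sq-u≤s) (+-mono-≤ sq-v≤s sq-v≤s)))

  open ≈-Reasoning ≈ᴹ-setoid

  lincomb-+ : ∀ {k} (c d : Vector ℝ k) e →
    lincomb c e +ᴹ lincomb d e ≈ᴹ lincomb (λ i → c i + d i) e
  lincomb-+ {zero}  c d e = +ᴹ-identityˡ 0ᴹ
  lincomb-+ {suc k} c d e = ≈ᴹ-trans (interchange _ _ _ _)
    (+ᴹ-cong (≈ᴹ-sym (*ₗ-distribʳ (e zero) (c zero) (d zero)))
      (lincomb-+ (c ∘ suc) (d ∘ suc) (e ∘ suc)))

  -ᴹ-*ₗ : ∀ c v → -ᴹ (c *ₗ v) ≈ᴹ (- c) *ₗ v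
  -ᴹ-*ₗ c v = ≈ᴹ-sym (GroupProperties.inverseˡ-unique +ᴹ-abelianGroup _ _
    (≈ᴹ-trans (≈ᴹ-sym (*ₗ-distribʳ v (- c) c))
      (≈ᴹ-trans (*ₗ-congʳ (+-inverseˡ c)) (*ₗ-zeroˡ v))))

  lincomb-neg : ∀ {k} (c : Vector ℝ k) e → -ᴹ lincomb c e ≈ᴹ lincomb (λ i → - c i) e
  lincomb-neg {zero}  c e = -0≈0
  lincomb-neg {suc k} c e = ≈ᴹ-trans (≈ᴹ-sym (-ᴹ-+ᴹ-comm _ _))
    (+ᴹ-cong (-ᴹ-*ₗ (c zero) (e zero)) (lincomb-neg (c ∘ suc) (e ∘ suc)))

  halve : ∀ {u v} → u +ᴹ u ≈ᴹ v +ᴹ v → u ≈ᴹ v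
  halve {u} {v} h = begin
    u                      ≈⟨ half-double u ⟨
    fromℚ ½ *ₗ (u +ᴹ u)    ≈⟨ *ₗ-congˡ h ⟩
    fromℚ ½ *ₗ (v +ᴹ v)    ≈⟨ half-double v ⟩
    v                      ∎
    where
    half-double : ∀ w → fromℚ ½ *ₗ (w +ᴹ w) ≈ᴹ w
    half-double w = begin
      fromℚ ½ *ₗ (w +ᴹ w)             ≈⟨ *ₗ-distribˡ (fromℚ ½) w w ⟩
      fromℚ ½ *ₗ w +ᴹ fromℚ ½ *ₗ w    ≈⟨ *ₗ-distribʳ w (fromℚ ½) (fromℚ ½) ⟨
      (fromℚ ½ + fromℚ ½) *ₗ w        ≈⟨ *ₗ-congʳ (≗⇒≈ λ _ → refl) ⟩
      1ℝ *ₗ w                         ≈⟨ *ₗ-identityˡ w ⟩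
      w                               ∎

-- Congruence modulo 2

module Doubling {a b} (G : AbelianGroup a b) where
  open AbelianGroup G
    using (Carrier; setoid; assoc; comm; ∙-cong; ∙-congˡ; ∙-congʳ; identityʳ; identityˡ; inverseʳ)
    renaming (_∙_ to _⊕_; ε to 𝟘; _⁻¹ to ⊝_; _≈_ to _≋_; sym to ≋-sym; trans to ≋-trans)
  open GroupProperties G using (⁻¹-∙-comm; ∙-cancelˡ)
  open CommutativeSemigroupProperties (AbelianGroup.commutativeSemigroup G) using (interchange)
  open ≈-Reasoning setoid

  -- The new witness is v - u. This serves the symmetry of `≡₂` and the comparison of words.
  transfer : ∀ {x y u v} → x ⊕ (u ⊕ u) ≋ y ⊕ (v ⊕ v) →
             x ≋ y ⊕ ((v ⊕ (⊝ u)) ⊕ (v ⊕ (⊝ u)))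
  transfer {x} {y} {u} {v} h = begin
    x                                    ≈⟨ identityʳ x ⟨
    x ⊕ 𝟘                                ≈⟨ ∙-congˡ (inverseʳ (u ⊕ u)) ⟨
    x ⊕ ((u ⊕ u) ⊕ (⊝ (u ⊕ u)))          ≈⟨ assoc x _ _ ⟨
    (x ⊕ (u ⊕ u)) ⊕ (⊝ (u ⊕ u))          ≈⟨ ∙-cong h (≋-sym (⁻¹-∙-comm u u)) ⟩
    (y ⊕ (v ⊕ v)) ⊕ ((⊝ u) ⊕ (⊝ u))      ≈⟨ assoc y _ _ ⟩
    y ⊕ ((v ⊕ v) ⊕ ((⊝ u) ⊕ (⊝ u)))      ≈⟨ ∙-congˡ (interchange v v (⊝ u) (⊝ u)) ⟩
    y ⊕ ((v ⊕ (⊝ u)) ⊕ (v ⊕ (⊝ u)))      ∎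

  module Mod2 {p} (_∈Λ : Carrier → Set p) (∈⊕ : ∀ {x y} → x ∈Λ → y ∈Λ → (x ⊕ y) ∈Λ)
              (∈⊝ : ∀ {x} → x ∈Λ → (⊝ x) ∈Λ) (∈𝟘 : 𝟘 ∈Λ) where

    infix 4 _≡₂_
    _≡₂_ : Carrier → Carrier → Set _
    x ≡₂ y = ∃[ w ] w ∈Λ × x ≋ y ⊕ (w ⊕ w)

    ≡₂-sym : ∀ {x y} → x ≡₂ y → y ≡₂ x
    ≡₂-sym {x} {y} (w , w∈ , h) = (𝟘 ⊕ (⊝ w)) , ∈⊕ ∈𝟘 (∈⊝ w∈) ,
      transfer (≋-trans (≋-sym h) (≋-sym (≋-trans (∙-congˡ (identityʳ 𝟘)) (identityʳ x))))

    ≡₂-cancelˡ : ∀ z {x y} → z ⊕ x ≡₂ z ⊕ y → x ≡₂ y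
    ≡₂-cancelˡ z {x} {y} (w , w∈ , h) = w , w∈ , ∙-cancelˡ z _ _ (≋-trans h (assoc z y _))

    ≡₂-respʳ : ∀ {x y z} → y ≋ z → x ≡₂ y → x ≡₂ z
    ≡₂-respʳ y≋z (w , w∈ , h) = w , w∈ , ≋-trans h (∙-congʳ y≋z)

    ≡₂-respˡ : ∀ {x y z} → x ≋ z → x ≡₂ y → z ≡₂ y
    ≡₂-respˡ x≋z (w , w∈ , h) = w , w∈ , ≋-trans (≋-sym x≋z) h

    x⊕x≡₂𝟘 : ∀ {x y} → x ∈Λ → y ≡₂ x ⊕ x → y ≡₂ 𝟘
    x⊕x≡₂𝟘 {x} {y} x∈ (w , w∈ , h) = (x ⊕ w) , ∈⊕ x∈ w∈ , (begin
      y                          ≈⟨ h ⟩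
      (x ⊕ x) ⊕ (w ⊕ w)          ≈⟨ interchange x x w w ⟩
      (x ⊕ w) ⊕ (x ⊕ w)          ≈⟨ identityˡ _ ⟨
      𝟘 ⊕ ((x ⊕ w) ⊕ (x ⊕ w))    ∎)

    -- The bound |Λ/2Λ| ≤ r in pigeonhole form, which avoids both the quotient and a decision
    -- procedure for `≡₂`.
    AtMostClasses : ℕ → Set _
    AtMostClasses r = ∀ {m} (y : Fin m → Carrier) → (∀ i → y i ∈Λ) → r ℕ.< m →
                      ∃[ i ] ∃[ j ] i ≢ j × y i ≡₂ y j

    -- If X is sum-free mod 2 and x ∈ X, then X and x + X are disjoint mod 2.
    sum-free-bound : ∀ {r k} → AtMostClasses r → (x : Fin k → Carrier) → (∀ i → x i ∈Λ) →
      (∀ i → ¬ x i ≡₂ 𝟘) →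
      (∀ i j → i ≢ j → ¬ x i ≡₂ x j) →
      (∀ i j l → i ≢ j → i ≢ l → j ≢ l → ¬ x i ≡₂ x j ⊕ x l) →
      k ℕ.+ k ≤ℕ r
    sum-free-bound {r} {zero}  _ _ _ _ _ _ = ℕ.z≤n
    sum-free-bound {r} {suc k} classes x x∈ ≢𝟘 distinct sum-free with suc k ℕ.+ suc k ℕ.≤? r
    ... | yes h = h
    ... | no ¬h =
      let i , j , i≢j , h = classes (λ i → y (splitAt (suc k) i))
                              (λ i → y∈ (splitAt (suc k) i)) (ℕ.≰⇒> ¬h)
      in ⊥-elim (clash (splitAt (suc k) i) (splitAt (suc k) j)
           (λ eq → i≢j (splitAt-injective i j eq)) h)
      where
      y : Fin (suc k) ⊎ Fin (suc k) → Carrier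
      y (inj₁ i) = x i
      -- For i = `zero` this lies in the class of 0, which contains no point of X.
      y (inj₂ i) = x zero ⊕ x i

      y∈ : ∀ s → y s ∈Λ
      y∈ (inj₁ i) = x∈ i
      y∈ (inj₂ i) = ∈⊕ (x∈ zero) (x∈ i)

      splitAt-injective : ∀ i j → splitAt (suc k) {suc k} i ≡ splitAt (suc k) j → i ≡ j
      splitAt-injective i j eq = trans (sym (join-splitAt (suc k) (suc k) i))
        (trans (cong (join (suc k) (suc k)) eq)
          (join-splitAt (suc k) (suc k) j))

      -- `sum-free` applies to three distinct indices. When two of i, `zero` and j coincide,
      -- cancelling leaves one of the points congruent to 0.
      clash′ : ∀ i j → ¬ x i ≡₂ x zero ⊕ x j
      clash′ i j h with zero ≟ j | i ≟ j | i ≟ zero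
      ... | yes refl | _ | _ = ≢𝟘 i (x⊕x≡₂𝟘 (x∈ zero) h)
      ... | no _ | yes refl | _ = ≢𝟘 zero (≡₂-sym (≡₂-cancelˡ (x i)
        (≡₂-respʳ (comm (x zero) (x i)) (≡₂-respˡ (≋-sym (identityʳ (x i))) h))))
      ... | no _ | no _ | yes refl = ≢𝟘 j (≡₂-sym (≡₂-cancelˡ (x zero)
        (≡₂-respˡ (≋-sym (identityʳ (x zero))) h)))
      ... | no 0≢j | no i≢j | no i≢0 = sum-free i zero j i≢0 i≢j 0≢j h

      clash : ∀ s t → s ≢ t → ¬ y s ≡₂ y t
      clash (inj₁ i) (inj₁ j) s≢t h = distinct i j (s≢t ∘ cong inj₁) h
      clash (inj₁ i) (inj₂ j) s≢t h = clash′ i j h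
      clash (inj₂ i) (inj₁ j) s≢t h = clash′ j i (≡₂-sym h)
      clash (inj₂ i) (inj₂ j) s≢t h =
        distinct i j (s≢t ∘ cong inj₂) (≡₂-cancelˡ (x zero) h)

    -- The sums Σ 2ᵗ y(cₜ) over words c of length n.
    module Words {m} (y : Fin m → Carrier) (y∈ : ∀ i → y i ∈Λ) where

      word    : ∀ n → Fin (m ^ n) → Carrier
      prepend : ∀ n → Fin m × Fin (m ^ n) → Carrier
      word zero    _ = 𝟘
      word (suc n) i = prepend n (remQuot (m ^ n) i)
      prepend n (c , r) = y c ⊕ (word n r ⊕ word n r)

      word∈ : ∀ n i → word n i ∈Λ
      word∈ zero    _ = ∈𝟘
      word∈ (suc n) i = let c , r = remQuot {m} (m ^ n) i in
        ∈⊕ (y∈ c) (∈⊕ (word∈ n r) (word∈ n r))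

      module _ (halve : ∀ {u v} → u ⊕ u ≋ v ⊕ v → u ≋ v) where

        -- Compare the lowest letters c and d. If they differ, the remaining parts are even and
        -- `y c ≡₂ y d`. If they agree, cancel them, halve and recurse. Hence m pairwise incongruent
        -- points have mⁿ different words of length n.
        equal-words : ∀ n i j → i ≢ j → word n i ≋ word n j →
                      ∃[ c ] ∃[ d ] c ≢ d × y c ≡₂ y d
        equal-prepends : ∀ n p q → p ≢ q → prepend n p ≋ prepend n q →
                         ∃[ c ] ∃[ d ] c ≢ d × y c ≡₂ y d
        equal-words zero    zero zero i≢j _ = ⊥-elim (i≢j refl)
        equal-words (suc n) i    j    i≢j h =
          equal-prepends n (remQuot (m ^ n) i) (remQuot (m ^ n) j)
            (λ eq → i≢j (trans (sym (combine-remQuot {m} (m ^ n) i))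
              (trans (cong (λ (c , r) → combine c r) eq) (combine-remQuot {m} (m ^ n) j))))
            h
        equal-prepends n (c , r) (d , s) p≢q h with c ≟ d
        ... | no c≢d   = c , d , c≢d , _ , ∈⊕ (word∈ n s) (∈⊝ (word∈ n r)) , transfer h
        ... | yes refl = equal-words n r s (λ r≡s → p≢q (cong (c ,_) r≡s))
                           (halve (∙-cancelˡ (y c) _ _ h))

-- Bernoulli's inequality 1 + n/p ≤ (1 + 1/p)ⁿ, multiplied by p^(n+1).
bernoulli : ∀ p n → (p ℕ.+ n) ℕ.* p ^ n ≤ℕ p ℕ.* suc p ^ n
bernoulli p zero    = ℕ.*-monoˡ-≤ 1 (ℕ.≤-reflexive (ℕ.+-identityʳ p))
bernoulli p (suc n) = begin
  (p ℕ.+ suc n) ℕ.* (p ℕ.* p ^ n)          ≤⟨ ℕ.m≤m+n _ (n ℕ.* p ^ n) ⟩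
  (p ℕ.+ suc n) ℕ.* (p ℕ.* p ^ n) ℕ.+ n ℕ.* p ^ n ≡⟨ lemma p n (p ^ n) ⟩
  suc p ℕ.* ((p ℕ.+ n) ℕ.* p ^ n)          ≤⟨ ℕ.*-monoʳ-≤ (suc p) (bernoulli p n) ⟩
  suc p ℕ.* (p ℕ.* suc p ^ n)              ≡⟨ swap p (suc p ^ n) ⟩
  p ℕ.* (suc p ℕ.* suc p ^ n)              ∎
  where
  open ℕ.≤-Reasoning
  lemma : ∀ p n q → (p ℕ.+ suc n) ℕ.* (p ℕ.* q) ℕ.+ n ℕ.* q ≡ suc p ℕ.* ((p ℕ.+ n) ℕ.* q)
  swap : ∀ p q → suc p ℕ.* (p ℕ.* q) ≡ p ℕ.* (suc p ℕ.* q)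
  swap = ℕ-Solver.solve-∀
  lemma = ℕ-Solver.solve-∀

-- With p = 2^(d+1), this makes the mⁿ words outnumber pⁿK boxes whenever m > p. The exponent n = pK
-- turns the factor p + n of `bernoulli` into p(1 + K).
exponential-gap : ∀ p K → .{{ℕ.NonZero p}} → ∃[ n ] p ^ n ℕ.* K ℕ.< suc p ^ n
exponential-gap p K = p ℕ.* K , ℕ.*-cancelˡ-< p _ _ (begin-strict
  p ℕ.* (p ^ n ℕ.* K)                    <⟨ ℕ.m<m+n _ (ℕ.m^n>0 p n) ⟩
  p ℕ.* (p ^ n ℕ.* K) ℕ.+ p ^ n          ≤⟨ ℕ.+-monoʳ-≤ (p ℕ.* (p ^ n ℕ.* K)) (ℕ.m≤n*m (p ^ n) p) ⟩
  p ℕ.* (p ^ n ℕ.* K) ℕ.+ p ℕ.* p ^ n    ≡⟨ lemma p K (p ^ n) ⟩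
  (p ℕ.+ n) ℕ.* p ^ n                    ≤⟨ bernoulli p n ⟩
  p ℕ.* suc p ^ n                        ∎)
  where
  n = p ℕ.* K
  open ℕ.≤-Reasoning
  lemma : ∀ p K q → p ℕ.* (q ℕ.* K) ℕ.+ p ℕ.* q ≡ (p ℕ.+ p ℕ.* K) ℕ.* q
  lemma = ℕ-Solver.solve-∀

-- The classes of Λ modulo 2

common-bound : ∀ {n} {P : Fin n → ℕ → Set} → (∀ i {b c} → b ≤ℕ c → P i b → P i c) →
               (∀ i → ∃[ b ] P i b) → ∃[ b ] ∀ i → P i b
common-bound {zero}  mono f = 0 , λ ()
common-bound {suc n} mono f =
  let b , Pb = f zero
      c , Pc = common-bound (λ i → mono (suc i)) (f ∘ suc)
  in b ℕ.⊔ c , λ { zero → mono zero (ℕ.m≤m⊔n b c) Pb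
                 ; (suc i) → mono (suc i) (ℕ.m≤n⊔m b c) (Pc i) }

ι-mono-< : ∀ {m n} → m ℕ.< n → ι m ℚ.< ι n
ι-mono-< {m} {n} m<n = ℚ.<-≤-trans
  (subst₂ ℚ._<_ (ℚ.+-identityʳ (ι m)) (sym (ι-suc m)) (ℚ.+-monoʳ-< (ι m) 0<1))
  (ι-mono m<n)

^-distribʳ-* : ∀ r m n → (m ℕ.* n) ^ r ≡ m ^ r ℕ.* n ^ r
^-distribʳ-* zero    m n = refl
^-distribʳ-* (suc r) m n = trans (cong (m ℕ.* n ℕ.*_) (^-distribʳ-* r m n))
  (interchange m n (m ^ r) (n ^ r))
  where
  interchange : ∀ m n p q → m ℕ.* n ℕ.* (p ℕ.* q) ≡ m ℕ.* p ℕ.* (n ℕ.* q)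
  interchange = ℕ-Solver.solve-∀

funToFin-injective : ∀ {m n} (f g : Fin m → Fin n) → funToFin f ≡ funToFin g → ∀ i → f i ≡ g i
funToFin-injective f g eq i = trans (sym (finToFun-funToFin f i))
  (trans (cong (λ k → finToFun k i) eq) (finToFun-funToFin g i))

-- With 2ⁿD cells for each of r coordinates, the number of boxes is a constant times (2^r)ⁿ, the
-- shape that `exponential-gap` compares with.
box-count : ∀ n r D → (2 ^ r) ^ n ℕ.* D ^ r ≡ (2 ^ n ℕ.* D) ^ r
box-count n r D = trans
  (cong (ℕ._* D ^ r) (trans (ℕ.^-*-assoc 2 r n)
    (trans (cong (2 ^_) (ℕ.*-comm r n)) (sym (ℕ.^-*-assoc 2 n r)))))
  (sym (^-distribʳ-* r (2 ^ n) D))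

-- Cells of width 1/(J + 1) are to cover [-2ⁿβ, 2ⁿβ]: exactly 2ⁿ · 2β(J + 1) of them have its
-- length, and the `suc` makes the inequality strict.
cells-suffice : ∀ β J n → ι (2 ^ n ℕ.* β) ℚ.+ ι (2 ^ n ℕ.* β) ℚ.<
                 ι (2 ^ n ℕ.* suc ((β ℕ.+ β) ℕ.* suc J)) ℚ.* 1/1+ J
cells-suffice β J n = subst (ℚ._< ι (2 ^ n ℕ.* suc ((β ℕ.+ β) ℕ.* suc J)) ℚ.* 1/1+ J) product
  (ℚ.*-monoˡ-<-pos (1/1+ J) {{ℚ.positive (0<1/1+ J)}}
    (ι-mono-< (subst (ℕ._< 2 ^ n ℕ.* suc ((β ℕ.+ β) ℕ.* suc J))
      (regroup (2 ^ n) β J)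
      (ℕ.*-monoʳ-< (2 ^ n) {{ℕ.m^n≢0 2 n}} (ℕ.n<1+n _)))))
  where
  regroup : ∀ p β J → p ℕ.* ((β ℕ.+ β) ℕ.* suc J) ≡ (p ℕ.* β ℕ.+ p ℕ.* β) ℕ.* suc J
  regroup = ℕ-Solver.solve-∀
  P = 2 ^ n ℕ.* β
  product : ι ((P ℕ.+ P) ℕ.* suc J) ℚ.* 1/1+ J ≡ ι P ℚ.+ ι P
  product = trans (cong (ℚ._* 1/1+ J) (ι-* (P ℕ.+ P) (suc J)))
    (trans (ℚ.*-assoc (ι (P ℕ.+ P)) (ι (suc J)) (1/1+ J))
      (trans (cong (ι (P ℕ.+ P) ℚ.*_) (ι-1/1+ J))
        (trans (ℚ.*-identityʳ _) (ι-+ P P))))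

module KroneckerLattice {a b p} (V : InnerProductSpace a b) (ℒ : Lattice V p)
                        (α : InnerProductSpace.Carrier V) where
  open InnerProductSpace V
  open Lattice ℒ
  open InnerProduct V
  open CommutativeSemigroupProperties (AbelianGroup.commutativeSemigroup +ᴹ-abelianGroup)
    using (interchange)
  open GroupProperties +ᴹ-abelianGroup using ()
    renaming (x∙y⁻¹≈ε⇒x≈y to x-y≈0⇒x≈y; ⁻¹-∙-comm to -ᴹ-+ᴹ-comm; ε⁻¹≈ε to -0≈0)

  G : AbelianGroup a b
  G = DirectProduct.abelianGroup ℤ.+-0-abelianGroup +ᴹ-abelianGroup

  open AbelianGroup G public using () renaming
    ( _∙_ to _⊕_; ε to 𝟘; _⁻¹ to ⊝_; _≈_ to _≋_
    ; sym to ≋-sym; trans to ≋-trans)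

  -- The level k is kept beside the vector because it makes Λ discrete: the vectors kα + ℓ alone may
  -- be dense in V.
  record _∈Λ (x : ℤ × Carrier) : Set (a ⊔ b ⊔ p) where
    constructor member
    field
      translation : ∃[ ℓ ] ℓ ∈ points × proj₂ x ≈ᴹ fromℤ (proj₁ x) *ₗ α +ᴹ ℓ

  ∈⊕ : ∀ {x y} → x ∈Λ → y ∈Λ → (x ⊕ y) ∈Λ
  ∈⊕ {k , u} {l , v} (member (m , m∈ , u≈)) (member (n , n∈ , v≈)) = member (m +ᴹ n , +∈ m∈ n∈ ,
    ≈ᴹ-trans (+ᴹ-cong u≈ v≈) (≈ᴹ-trans (interchange _ _ _ _)
      (+ᴹ-congʳ (≈ᴹ-trans (≈ᴹ-sym (*ₗ-distribʳ α (fromℤ k) (fromℤ l)))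
        (*ₗ-congʳ (≈-sym (fromℤ-+ k l)))))))

  ∈⊝ : ∀ {x} → x ∈Λ → (⊝ x) ∈Λ
  ∈⊝ {k , u} (member (m , m∈ , u≈)) = member (-ᴹ m , -∈ m∈ ,
    ≈ᴹ-trans (-ᴹ‿cong u≈) (≈ᴹ-trans (≈ᴹ-sym (-ᴹ-+ᴹ-comm _ _))
      (+ᴹ-congʳ (≈ᴹ-trans (-ᴹ-*ₗ (fromℤ k) α) (*ₗ-congʳ (≈-sym (fromℤ-neg k)))))))

  ∈𝟘 : 𝟘 ∈Λ
  ∈𝟘 = member (0ᴹ , 0∈ , ≈ᴹ-sym (≈ᴹ-trans (+ᴹ-identityʳ _)
    (≈ᴹ-trans (*ₗ-congʳ (≗⇒≈ λ _ → refl)) (*ₗ-zeroˡ α))))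

  open Doubling.Mod2 G _∈Λ ∈⊕ ∈⊝ ∈𝟘 public

  ⊕-halve : ∀ {x y} → x ⊕ x ≋ y ⊕ y → x ≋ y
  ⊕-halve {k , _} {l , _} (k+k≡l+l , h) = ℤ.*-cancelʳ-≡ k l (+ 2)
    (trans (double k) (trans k+k≡l+l (sym (double l)))) , halve h
    where
    double : ∀ k → k ℤ.* + 2 ≡ k ℤ.+ k
    double = ℤ-Solver.solve-∀

  -- Discreteness at 0, restated with a rational bound on the squared norm, to which
  -- `sq-lincomb-small` applies.
  isolated : ∃[ r ] 0ℚ ℚ.< r × (∀ {v} → v ∈ points → sq v ≤ fromℚ r → v ≈ᴹ 0ᴹ)
  isolated =
    let ε , 0<ε , near⇒≈0   = discrete 0∈
        η , 0<η , N , f     = <-elim 0<ε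
        -- Half of the margin η: the stages of the norm end up at most θ, and θ + θ = η leaves θ for
        -- the strict inequality. The radius θ²/2 leaves the other half of θ² to the tolerance in
        -- `≤`.
        θ                   = ½ ℚ.* η
        0<θ                 = half 0<η
        θ²                  = θ ℚ.* θ
        0<½θ²               = half (0<* 0<θ 0<θ)
    in ½ ℚ.* θ² , 0<½θ² , λ {v} v∈ sq-v≤ → near⇒≈0 v∈ (<-intro
         (let M , g = ≤-elim (≤-resp-≈ (sq-cong (≈ᴹ-sym (v-0≈v v))) (≈-refl {fromℚ (½ ℚ.* θ²)}) sq-v≤)
                        (½ ℚ.* θ²) 0<½θ²
          in θ , 0<θ , M ℕ.⊔ N , λ n n≥ → ℚ.≤-trans
               (ℚ.+-monoˡ-≤ θ (√-upper {sq (v -ᴹ 0ᴹ)} {n} (ℚ.<⇒≤ 0<θ)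
                 (ℚ.≤-trans (g n (ℕ.m⊔n≤o⇒m≤o M N n≥)) (ℚ.≤-reflexive (½+½ θ²)))))
               (ℚ.≤-trans (ℚ.≤-reflexive (trans (½+½ η) (sym (ℚ.+-identityˡ η))))
                 (f n (ℕ.m⊔n≤o⇒n≤o M N n≥)))))
    where
    v-0≈v : ∀ v → v -ᴹ 0ᴹ ≈ᴹ v
    v-0≈v v = ≈ᴹ-trans (+ᴹ-congˡ -0≈0) (+ᴹ-identityʳ v)

  module _ {d} (e : Vector Carrier d) where

    HasCoordinates : ℤ × Carrier → Vector ℝ (suc d) → Set _
    HasCoordinates (k , v) c = fromℤ k ≈ c zero × v ≈ᴹ lincomb (c ∘ suc) e

    HasCoordinates-⊕ : ∀ x y c c′ → HasCoordinates x c → HasCoordinates y c′ →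
                       HasCoordinates (x ⊕ y) (λ i → c i + c′ i)
    HasCoordinates-⊕ (k , _) (l , _) c c′ (k≈ , u≈) (l≈ , v≈) =
      ≈-trans (fromℤ-+ k l) (+-cong k≈ l≈) ,
      ≈ᴹ-trans (+ᴹ-cong u≈ v≈) (lincomb-+ _ _ e)

    HasCoordinates-⊝ : ∀ x c → HasCoordinates x c → HasCoordinates (⊝ x) (λ i → - c i)
    HasCoordinates-⊝ (k , _) c (k≈ , u≈) =
      ≈-trans (fromℤ-neg k) (-‿cong k≈) ,
      ≈ᴹ-trans (-ᴹ‿cong u≈) (lincomb-neg _ e)

    HasCoordinates-𝟘 : HasCoordinates 𝟘 (λ _ → 0ℝ)
    HasCoordinates-𝟘 = ≗⇒≈ (λ _ → refl) , zeros e
      where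
      zeros : ∀ {k} (e : Vector Carrier k) → 0ᴹ ≈ᴹ lincomb (λ _ → 0ℝ) e
      zeros {zero}  e = ≈ᴹ-refl
      zeros {suc k} e = ≈ᴹ-trans (≈ᴹ-sym (+ᴹ-identityˡ 0ᴹ))
        (+ᴹ-cong (≈ᴹ-sym (*ₗ-zeroˡ (e zero))) (zeros (e ∘ suc)))

    -- The level of x - y is an integer of size at most 1/2, hence 0, so the vector of x - y lies in
    -- `points`. Its small coordinates make it short, hence 0 by `isolated`.
    coordinates-separate : ∃[ δ ] 0ℚ ℚ.< δ × (∀ x y c c′ → x ∈Λ → y ∈Λ →
      HasCoordinates x c → HasCoordinates y c′ →
      (∀ i → Bounded δ (c i + - c′ i)) → x ≋ y)
    coordinates-separate =
      let r , 0<r , near⇒≈0   = isolated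
          δ₁ , 0<δ₁ , small   = sq-lincomb-small e 0<r
          δ , 0<δ , ≤δ₁ , ≤½  = positive-lower-bound 0<δ₁ 0<½
      in δ , 0<δ , λ x y c c′ x∈ y∈ x~c y~c′ close →
         let z∈       = ∈⊕ x∈ (∈⊝ y∈)
             k≈ , v≈  = HasCoordinates-⊕ x (⊝ y) c (λ i → - c′ i) x~c (HasCoordinates-⊝ y c′ y~c′)
             k≡0      = Bounded-½⇒0 _ k≈ (Bounded-mono {x = c zero + - c′ zero} ≤½ (close zero))
             member (ℓ , ℓ∈ , v≈ℓ) = subst (λ k → (k , proj₂ x +ᴹ -ᴹ proj₂ y) ∈Λ) k≡0 z∈
             v∈       = ∈-resp-≈ᴹ (≈ᴹ-sym (≈ᴹ-trans v≈ℓ (≈ᴹ-trans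
                          (+ᴹ-congʳ (≈ᴹ-trans (*ₗ-congʳ (≗⇒≈ λ _ → refl)) (*ₗ-zeroˡ α)))
                          (+ᴹ-identityˡ ℓ)))) ℓ∈
             sq≤r     = ≤-resp-≈ (sq-cong (≈ᴹ-sym v≈)) (≈-refl {fromℚ r})
                          (small (λ i → c (suc i) + - c′ (suc i))
                            (λ i → Bounded-mono {x = c (suc i) + - c′ (suc i)} ≤δ₁ (close (suc i))))
         in ℤ.i-j≡0⇒i≡j _ _ k≡0 , x-y≈0⇒x≈y _ _ (near⇒≈0 v∈ sq≤r)

    module _ {m} (y : Fin m → ℤ × Carrier) (y∈ : ∀ i → y i ∈Λ)
             (c : Fin m → Vector ℝ (suc d)) (y~c : ∀ i → HasCoordinates (y i) (c i)) where
      open Words y y∈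

      wordCoordinates : ∀ n → Fin (m ^ n) → Vector ℝ (suc d)
      wordCoordinates zero    _ _ = 0ℝ
      wordCoordinates (suc n) i j = let a , r = remQuot (m ^ n) i in
        c a j + (wordCoordinates n r j + wordCoordinates n r j)

      word~wordCoordinates : ∀ n i → HasCoordinates (word n i) (wordCoordinates n i)
      word~wordCoordinates zero    _ = HasCoordinates-𝟘
      word~wordCoordinates (suc n) i = let a , r = remQuot {m} (m ^ n) i in
        HasCoordinates-⊕ (y a) (word n r ⊕ word n r) (c a)
          (λ j → wordCoordinates n r j + wordCoordinates n r j) (y~c a)
          (HasCoordinates-⊕ (word n r) (word n r) (wordCoordinates n r) (wordCoordinates n r)
            (word~wordCoordinates n r) (word~wordCoordinates n r))

      wordCoordinates-bounded : ∀ β → (∀ i j → Bounded (ι β) (c i j)) →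
        ∀ n i j → Bounded (ι (2 ^ n ℕ.* β)) (wordCoordinates n i j)
      wordCoordinates-bounded β c-bounded n i j =
        Bounded-mono {x = wordCoordinates n i j}
          (≤-by (ι β) (ι-nonNeg β)
            (solve 2 (λ p q → (p :- q) :+ q := p) refl (ι (2 ^ n ℕ.* β)) (ι β)))
          (go n i)
        where
        -- The term -β absorbs the letter added in each step: β + 2(2ⁿβ - β) = 2ⁿ⁺¹β - β.
        go : ∀ n i → Bounded (ι (2 ^ n ℕ.* β) ℚ.- ι β) (wordCoordinates n i j)
        go zero    i = 0 , λ _ _ → ℚ.≤-reflexive (sym (trans
          (cong (λ k → ι k ℚ.- ι β) (ℕ.*-identityˡ β)) (ℚ.+-inverseʳ (ι β))))
        go (suc n) i = let a , r = remQuot {m} (m ^ n) i in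
          subst (λ q → Bounded q (c a j + (wordCoordinates n r j + wordCoordinates n r j)))
            (trans
              (solve 2 (λ p q → q :+ ((p :- q) :+ (p :- q)) := (p :+ p) :- q) refl
                (ι (2 ^ n ℕ.* β)) (ι β))
              (cong (ℚ._- ι β) (trans (sym (ι-+ (2 ^ n ℕ.* β) (2 ^ n ℕ.* β)))
                (cong ι (double (2 ^ n) β)))))
            (Bounded-+ {x = c a j} {wordCoordinates n r j + wordCoordinates n r j} (c-bounded a j)
              (Bounded-+ {x = wordCoordinates n r j} {wordCoordinates n r j} (go n r) (go n r)))
          where
          double : ∀ p β → p ℕ.* β ℕ.+ p ℕ.* β ≡ (p ℕ.+ (p ℕ.+ 0)) ℕ.* β
          double = ℕ-Solver.solve-∀

      module Boxes (β : ℕ) (c-bounded : ∀ i j → Bounded (ι β) (c i j)) (J n : ℕ) where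

        private
          M = 2 ^ n ℕ.* suc ((β ℕ.+ β) ℕ.* suc J)
          h = 1/1+ J
          module Cell = Cells h (ι (2 ^ n ℕ.* β)) (0<1/1+ J) M (cells-suffice β J n)
          co = wordCoordinates n
          bounds = wordCoordinates-bounded β c-bounded n

        box : Fin (m ^ n) → Fin (M ^ suc d)
        box i = funToFin λ k → Cell.cellOf (co i k) (bounds i k)

        same-box : ∀ i j → box i ≡ box j → ∀ k → Bounded (h ℚ.+ h ℚ.+ h) (co i k + - co j k)
        same-box i j eq k = Cell.cellOf-near {co i k} {co j k} (bounds i k) (bounds j k)
          (funToFin-injective (λ k → Cell.cellOf (co i k) (bounds i k))
            (λ k → Cell.cellOf (co j k) (bounds j k)) eq k)

        -- Two words in one box agree up to 3h in every coordinate, so they are equal, and equal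
        -- words yield congruent letters.
        collision : ∀ {δ} → h ℚ.+ h ℚ.+ h ℚ.≤ δ →
          (∀ x y c c′ → x ∈Λ → y ∈Λ → HasCoordinates x c → HasCoordinates y c′ →
            (∀ i → Bounded δ (c i + - c′ i)) → x ≋ y) →
          M ^ suc d ℕ.< m ^ n → ∃[ i ] ∃[ j ] i ≢ j × y i ≡₂ y j
        collision 3h≤δ separate fewer =
          let i , j , i<j , same = pigeonhole fewer box
          in equal-words ⊕-halve n i j (<⇒≢ i<j)
               (separate (word n i) (word n j) (co i) (co j) (word∈ n i) (word∈ n j)
                 (word~wordCoordinates n i) (word~wordCoordinates n j)
                 (λ k → Bounded-mono {x = co i k + - co j k} 3h≤δ (same-box i j same k)))

      coordinates-bounded : ∃[ β ] ∀ i j → Bounded (ι β) (c i j)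
      coordinates-bounded = common-bound
        (λ i p≤q f j → Bounded-mono {x = c i j} (ι-mono p≤q) (f j))
        (λ i → common-bound
          (λ j p≤q → Bounded-mono {x = c i j} (ι-mono p≤q))
          (λ j → let B , _ , B-bound = eventually-bounded (c i j)
                 in _ , Bounded-mono {x = c i j} (bound B) B-bound))

  -- The mⁿ words of length n lie in O(2ⁿ)^(d+1) boxes, and a box contains
  -- at most one point of Λ.
  classes : ∀ {d} → HasDimension d → AtMostClasses (2 ^ suc d)
  classes {d} (e , _ , span) {m} y y∈ 2^1+d<m =
    let δ , 0<δ , separate = coordinates-separate e
        -- Words in one box differ by up to three cell widths, so the width 1/(J + 1) is taken at
        -- most δ/3.
        σ , 0<σ , 3σ≡δ     = shrink (ι 3) (ℚ.positive⁻¹ (ι 3)) 0<δ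
        J , 1/1+≤σ         = archimedean 0<σ
        β , c-bounded      = coordinates-bounded e y y∈ c y~c
        D                  = suc ((β ℕ.+ β) ℕ.* suc J)
        n , fewer          = exponential-gap (2 ^ suc d) (D ^ suc d) {{ℕ.m^n≢0 2 (suc d)}}
    in Boxes.collision e y y∈ c y~c β c-bounded J n
         (ℚ.≤-trans (ℚ.≤-reflexive (triple (1/1+ J)))
           (ℚ.≤-trans (ℚ.*-monoˡ-≤-nonNeg (ι 3) (1/1+≤σ ℕ.≤-refl)) (ℚ.≤-reflexive 3σ≡δ)))
         separate
         (ℕ.<-≤-trans (subst (ℕ._< suc (2 ^ suc d) ^ n) (box-count n (suc d) D) fewer)
           (ℕ.^-monoˡ-≤ n 2^1+d<m))
    where
    c : Fin m → Vector ℝ (suc d)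
    c i = fromℤ (proj₁ (y i)) ∷ proj₁ (span (proj₂ (y i)))

    y~c : ∀ i → HasCoordinates e (y i) (c i)
    y~c i = ≈-refl , proj₂ (span (proj₂ (y i)))

    triple : ∀ h → h ℚ.+ h ℚ.+ h ≡ ι 3 ℚ.* h
    triple = solve 1 (λ h → h :+ h :+ h := con (ι 3) :* h) refl

-- Gaps

argmin : ∀ {n} (t : Fin (suc n) → ℕ) → ∃[ b ] ∀ i → t b ≤ℕ t i
argmin {zero}  t = zero , λ { zero → ℕ.≤-refl }
argmin {suc n} t with argmin (t ∘ suc)
... | b , tb≤ with ℕ.≤-total (t zero) (t (suc b))
...   | inj₁ t0≤tb = zero , λ { zero → ℕ.≤-refl ; (suc i) → ℕ.≤-trans t0≤tb (tb≤ i) }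
...   | inj₂ tb≤t0 = suc b , λ { zero → tb≤t0 ; (suc i) → tb≤ i }

double-cancel-≤ : ∀ {m n} → m ℕ.+ m ≤ℕ n ℕ.+ n → m ≤ℕ n
double-cancel-≤ {m} {n} h with m ℕ.≤? n
... | yes m≤n = m≤n
... | no m≰n  = ⊥-elim (ℕ.<⇒≱ (ℕ.+-mono-< (ℕ.≰⇒> m≰n) (ℕ.≰⇒> m≰n)) h)

-- 2k = m - s is a difference of two numbers in [0, 2T].
∣half-difference∣≤ : ∀ {m s T} k → m ≤ℕ T ℕ.+ T → s ≤ℕ T ℕ.+ T →
                     + m ≡ + s ℤ.+ (k ℤ.+ k) → ℤ.∣ k ∣ ≤ℕ T
∣half-difference∣≤ {m} {s} (+ n) m≤ s≤ eq = double-cancel-≤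
  (ℕ.≤-trans (ℕ.m≤n+m (n ℕ.+ n) s) (subst (_≤ℕ _) (ℤ.+-injective eq) m≤))
∣half-difference∣≤ {m} {s} -[1+ n ] m≤ s≤ eq = double-cancel-≤
  (ℕ.≤-trans (ℕ.m≤n+m (suc n ℕ.+ suc n) m) (subst (_≤ℕ _) (ℤ.+-injective s≡) s≤))
  where
  cancel : ∀ s k → s ≡ s ℤ.+ (ℤ.- k ℤ.+ ℤ.- k) ℤ.+ (k ℤ.+ k)
  cancel = ℤ-Solver.solve-∀
  s≡ : + s ≡ + (m ℕ.+ (suc n ℕ.+ suc n))
  s≡ = trans (cancel (+ s) (+ suc n)) (cong (ℤ._+ (+ suc n ℤ.+ + suc n)) (sym eq))

-- s + t - r = 2a.
triangle⇒nonNegative : ∀ {r s t} a b c → + s ≡ a ℤ.+ b → + t ≡ a ℤ.+ c → + r ≡ b ℤ.+ c →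
                       r ≤ℕ s ℕ.+ t → ∃[ n ] a ≡ + n
triangle⇒nonNegative (+ n) b c _ _ _ _ = n , refl
triangle⇒nonNegative {r} {s} {t} -[1+ n ] b c s≡ t≡ r≡ r≤s+t =
  ⊥-elim (ℕ.<⇒≱ (ℕ.m<m+n (s ℕ.+ t) ℕ.z<s) (subst (_≤ℕ s ℕ.+ t) (ℤ.+-injective r≡′) r≤s+t))
  where
  regroup : ∀ k b c → b ℤ.+ c ≡ (ℤ.- k ℤ.+ b) ℤ.+ (ℤ.- k ℤ.+ c) ℤ.+ (k ℤ.+ k)
  regroup = ℤ-Solver.solve-∀
  r≡′ : + r ≡ + (s ℕ.+ t ℕ.+ (suc n ℕ.+ suc n))
  r≡′ = trans r≡ (trans (regroup (+ suc n) b c)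
    (cong₂ (λ x y → x ℤ.+ y ℤ.+ (+ suc n ℤ.+ + suc n)) (sym s≡) (sym t≡)))

-- Half-sums of three levels in (T, 2T].
half-sum-levels : ∀ {x y z T} a b c → T ℕ.< x → x ℕ.< y → y ℕ.< z → z ≤ℕ T ℕ.+ T →
  + x ≡ a ℤ.+ b → + y ≡ a ℤ.+ c → + z ≡ b ℤ.+ c →
  (ℤ.∣ a ∣ ≤ℕ T × ℤ.∣ b ∣ ≤ℕ T) × (ℤ.∣ a ∣ ≤ℕ x × ℤ.∣ b ∣ ≤ℕ x × ℤ.∣ c ∣ ≤ℕ y)
half-sum-levels {x} {y} {z} {T} a b c T<x x<y y<z z≤2T x≡ y≡ z≡
  -- Only for a is the window (T, 2T] needed, through z ≤ 2T ≤ x + y. The other two triangle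
  -- inequalities follow from x < y < z.
  with triangle⇒nonNegative a b c x≡ y≡ z≡
         (ℕ.≤-trans z≤2T (ℕ.+-mono-≤ (ℕ.<⇒≤ T<x) (ℕ.<⇒≤ (ℕ.<-trans T<x x<y))))
     | triangle⇒nonNegative b a c (trans x≡ (ℤ.+-comm a b)) z≡ y≡
         (ℕ.≤-trans (ℕ.<⇒≤ y<z) (ℕ.m≤n+m z x))
     | triangle⇒nonNegative c a b (trans y≡ (ℤ.+-comm a c)) (trans z≡ (ℤ.+-comm b c)) x≡
         (ℕ.≤-trans (ℕ.<⇒≤ x<y) (ℕ.m≤m+n y z))
... | k , refl | l , refl | m , refl
  with ℤ.+-injective x≡ | ℤ.+-injective y≡ | ℤ.+-injective z≡
... | refl | refl | refl =
  (ℕ.≤-trans (ℕ.<⇒≤ k<l) l≤T , l≤T) , (ℕ.m≤m+n k l , ℕ.m≤n+m l k , ℕ.m≤n+m m k)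
  where
  -- Now x = k + l, y = k + m and z = l + m, so the order of the levels gives k < l < m, and 2l ≤ l
  -- + m ≤ 2T. Only m may exceed T.
  k<l : k ℕ.< l
  k<l = ℕ.+-cancelʳ-< m k l y<z
  l<m : l ℕ.< m
  l<m = ℕ.+-cancelˡ-< k l m x<y
  l≤T : l ≤ℕ T
  l≤T = double-cancel-≤ (ℕ.≤-trans (ℕ.+-monoʳ-≤ l (ℕ.<⇒≤ l<m)) z≤2T)

module GapCount {a b p} (V : InnerProductSpace a b) (ℒ : Lattice V p)
                (α : InnerProductSpace.Carrier V) where
  open InnerProductSpace V
  open InnerProduct V
  open KroneckerLattice V ℒ α
  open Lattice ℒ using (points)
  open AbelianGroup G using (∙-congʳ; assoc; comm; inverseˡ; identityˡ)
  open CommutativeSemigroupProperties (AbelianGroup.commutativeSemigroup G) using (interchange)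

  -- The i-th gap is the norm of vec i; it is the least one among the points
  -- of Λ with level in [- reach i , reach i].
  record GapSystem (g : ℕ) : Set (a ⊔ b ⊔ p) where
    field
      reach level : Fin g → ℕ
      vec         : Fin g → Carrier
      point∈      : ∀ i → (+ level i , vec i) ∈Λ
      level≤reach : ∀ i → level i ≤ℕ reach i
      vec≉0       : ∀ i → ¬ vec i ≈ᴹ 0ᴹ
      minimal     : ∀ i {k w} → (k , w) ∈Λ → ¬ w ≈ᴹ 0ᴹ → ℤ.∣ k ∣ ≤ℕ reach i →
                    sq (vec i) ≤ sq w
      distinct    : ∀ {i j} → sq (vec i) ≈ sq (vec j) → i ≡ j
      reach≤      : ∀ i j → reach i ≤ℕ reach j ℕ.+ reach j

    point : Fin g → ℤ × Carrier
    point i = + level i , vec i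

    antitone : ∀ {i j} → reach i ≤ℕ reach j → sq (vec j) ≤ sq (vec i)
    antitone {i} {j} h = minimal j (point∈ i) (vec≉0 i) (ℕ.≤-trans (level≤reach i) h)

    strict : ∀ {i j} → i ≢ j → reach i ≤ℕ reach j → ¬ sq (vec i) ≤ sq (vec j)
    strict i≢j h k = i≢j (distinct (≤-antisym k (antitone h)))

    -- Otherwise point j would compete for gap i, although its vector is strictly shorter than
    -- `vec i`.
    reach<level : ∀ {i j} → i ≢ j → reach i ≤ℕ reach j → reach i ℕ.< level j
    reach<level {i} {j} i≢j h = ℕ.≰⇒> λ level≤ →
      strict i≢j h (minimal i (point∈ j) (vec≉0 j) level≤)

  module _ {g} (S : GapSystem g) (o : Fin g)
           (o-least : ∀ i → GapSystem.reach S o ≤ℕ GapSystem.reach S i) where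
    open GapSystem S

    private
      T : ℕ
      T = reach o

      level≤2T : ∀ i → level i ≤ℕ T ℕ.+ T
      level≤2T i = ℕ.≤-trans (level≤reach i) (reach≤ i o)

    -- Nonzero vectors at level at most T are no shorter than `vec o`, whereas `vec i` is strictly
    -- shorter. This is what shows half-sums to be nonzero.
    not-low : ∀ {i k w} → o ≢ i → (k , w) ∈Λ → ℤ.∣ k ∣ ≤ℕ T → ¬ vec i ≈ᴹ w
    not-low {i} o≢i w∈ k≤T v≈w = strict o≢i (o-least i)
      (≤-resp-≈ ≈-refl (sq-cong (≈ᴹ-sym v≈w))
        (minimal o w∈ (λ w≈0 → vec≉0 i (≈ᴹ-trans v≈w w≈0)) k≤T))

    -- Suppose `vec i` = u + 2w. Then w is nonzero and has level at most T, so `parallelogram` gives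
    -- |`vec i`|² + |u|² ≥ 2|w|² ≥ 2|`vec o`|². As |u| ≤ |`vec o`|, `vec i` would be no shorter than
    -- `vec o`. The case u = 0 makes the classes nonzero, the case u = `vec j` makes them distinct.
    not-congruent : ∀ {i s u} → o ≢ i → s ≤ℕ T ℕ.+ T → sq u ≤ sq (vec o) → ¬ vec i ≈ᴹ u →
                    ¬ point i ≡₂ (+ s , u)
    not-congruent {i} {s} {u} o≢i s≤2T u≤ v≉u ((k , w) , w∈ , level≡ , v≈) =
      strict o≢i (o-least i) (+-cancelʳ-≤ (sq (vec o)) (≤-trans
        (≤-trans (+-mono-≤ o≤w o≤w) (≤-resp-≈ ≈-refl (+-comm _ _) (x≤x+y (0≤x+y (⟨⟩-nonNeg (u +ᴹ w)) (⟨⟩-nonNeg (u +ᴹ w))))))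
        (≤-resp-≈ (≈-trans (+-cong (sq-cong v≈) ≈-refl) (parallelogram u w)) ≈-refl
          (+-mono-≤ ≤-refl u≤))))
      where
      w≉0 : ¬ w ≈ᴹ 0ᴹ
      w≉0 w≈0 = v≉u (≈ᴹ-trans v≈ (≈ᴹ-trans (+ᴹ-congˡ (≈ᴹ-trans (+ᴹ-cong w≈0 w≈0) (+ᴹ-identityˡ 0ᴹ))) (+ᴹ-identityʳ u)))
      o≤w : sq (vec o) ≤ sq w
      o≤w = minimal o w∈ w≉0 (∣half-difference∣≤ k (level≤2T i) s≤2T level≡)

    -- For the points i, j, l these are the half-sums A = (i + j - l)/2, B = (i + l - j)/2 and C =
    -- (j + l - i)/2. The form survives permutations of the points, so they may be sorted by reach.
    Split : (i j l : Fin g) → Set _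
    Split i j l = ∃[ A ] ∃[ B ] ∃[ C ] (A ∈Λ × B ∈Λ × C ∈Λ) ×
      point i ≋ A ⊕ B × point j ≋ A ⊕ C × point l ≋ B ⊕ C

    -- By pairwise-sums, |A+B|² + |A+C|² + |B+C|² ≥ |A|² + |B|² + |C|², while
    -- the levels of A, B and C are so small that |A|², |B|² ≥ |A+B|² > |B+C|²
    -- and |C|² ≥ |A+C|².
    no-sorted-split : ∀ {i j l} → o ≢ i → o ≢ j → i ≢ j → j ≢ l → i ≢ l →
      reach i ≤ℕ reach j → reach j ≤ℕ reach l → ¬ Split i j l
    no-sorted-split {i} {j} {l} o≢i o≢j i≢j j≢l i≢l i≤j j≤l
      ((a , A) , (b , B) , (c , C) , (A∈ , B∈ , C∈) , (i≡ , i≈) , (j≡ , j≈) , (l≡ , l≈)) =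
      strict i≢l (ℕ.≤-trans i≤j j≤l) (+-cancelʳ-≤ (sq (vec i) + sq (vec j))
        (≤-resp-≈ (+-assoc _ _ _) (rotate _ _ _)
          (≤-trans (+-mono-≤ (+-mono-≤ i≤A i≤B) j≤C)
            (≤-resp-≈ ≈-refl
              (≈-trans (≈-sym (pairwise-sums A B C))
                (≈-sym (+-cong (+-cong (sq-cong i≈) (sq-cong j≈)) (sq-cong l≈))))
              (x≤x+y (⟨⟩-nonNeg (A +ᴹ B +ᴹ C)))))))
      where
      -- Each level is at most its own reach, which lies below the level of the next point, so T <
      -- `level i` < `level j` < `level l`.
      bounds = half-sum-levels a b c (reach<level o≢i (o-least i))
        (ℕ.≤-<-trans (level≤reach i) (reach<level i≢j i≤j))
        (ℕ.≤-<-trans (level≤reach j) (reach<level j≢l j≤l))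
        (level≤2T l) i≡ j≡ l≡
      a≤T = proj₁ (proj₁ bounds)
      b≤T = proj₂ (proj₁ bounds)
      a≤i = proj₁ (proj₂ bounds)
      b≤i = proj₁ (proj₂ (proj₂ bounds))
      c≤j = proj₂ (proj₂ (proj₂ bounds))

      drop-left : ∀ {u v w} → u ≈ᴹ v +ᴹ w → v ≈ᴹ 0ᴹ → u ≈ᴹ w
      drop-left u≈ v≈0 = ≈ᴹ-trans u≈ (≈ᴹ-trans (+ᴹ-congʳ v≈0) (+ᴹ-identityˡ _))
      drop-right : ∀ {u v w} → u ≈ᴹ v +ᴹ w → w ≈ᴹ 0ᴹ → u ≈ᴹ v
      drop-right u≈ w≈0 = ≈ᴹ-trans u≈ (≈ᴹ-trans (+ᴹ-congˡ w≈0) (+ᴹ-identityʳ _))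

      -- If one summand vanished, the other would equal the gap vector while having level at most T.
      -- For `vec j` = A + C the survivor is A, since the level of C may exceed T.
      i≤A : sq (vec i) ≤ sq A
      i≤A = minimal i A∈ (λ A≈0 → not-low o≢i B∈ b≤T (drop-left i≈ A≈0))
        (ℕ.≤-trans a≤i (level≤reach i))
      i≤B : sq (vec i) ≤ sq B
      i≤B = minimal i B∈ (λ B≈0 → not-low o≢i A∈ a≤T (drop-right i≈ B≈0))
        (ℕ.≤-trans b≤i (level≤reach i))
      j≤C : sq (vec j) ≤ sq C
      j≤C = minimal j C∈ (λ C≈0 → not-low o≢j A∈ a≤T (drop-right j≈ C≈0))
        (ℕ.≤-trans c≤j (level≤reach j))

      rotate : ∀ x y z → x + y + z ≈ z + (x + y)
      rotate x y z = +-comm (x + y) z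

    swapˡ : ∀ {i j l} → Split i j l → Split j i l
    swapˡ (A , B , C , (A∈ , B∈ , C∈) , i≋ , j≋ , l≋) =
      A , C , B , (A∈ , C∈ , B∈) , j≋ , i≋ , ≋-trans l≋ (comm B C)

    swapʳ : ∀ {i j l} → Split i j l → Split i l j
    swapʳ (A , B , C , (A∈ , B∈ , C∈) , i≋ , j≋ , l≋) =
      B , A , C , (B∈ , A∈ , C∈) , ≋-trans i≋ (comm A B) , l≋ , j≋

    no-split : ∀ {i j l} → o ≢ i → o ≢ j → o ≢ l → i ≢ j → i ≢ l → j ≢ l → ¬ Split i j l
    no-split {i} {j} {l} o≢i o≢j o≢l i≢j i≢l j≢l s
      with ℕ.≤-total (reach i) (reach j) | ℕ.≤-total (reach j) (reach l) | ℕ.≤-total (reach i) (reach l)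
    ... | inj₁ i≤j | inj₁ j≤l | _        = no-sorted-split o≢i o≢j i≢j j≢l i≢l i≤j j≤l s
    ... | inj₁ i≤j | inj₂ l≤j | inj₁ i≤l = no-sorted-split o≢i o≢l i≢l (≢-sym j≢l) i≢j i≤l l≤j (swapʳ s)
    ... | inj₁ i≤j | inj₂ l≤j | inj₂ l≤i = no-sorted-split o≢l o≢i (≢-sym i≢l) i≢j (≢-sym j≢l) l≤i i≤j (swapˡ (swapʳ s))
    ... | inj₂ j≤i | inj₁ j≤l | inj₁ i≤l = no-sorted-split o≢j o≢i (≢-sym i≢j) i≢l j≢l j≤i i≤l (swapˡ s)
    ... | inj₂ j≤i | inj₁ j≤l | inj₂ l≤i = no-sorted-split o≢j o≢l j≢l (≢-sym i≢l) (≢-sym i≢j) j≤l l≤i (swapʳ (swapˡ s))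
    ... | inj₂ j≤i | inj₂ l≤j | _        = no-sorted-split o≢l o≢j (≢-sym j≢l) (≢-sym i≢j) (≢-sym i≢l) l≤j j≤i (swapˡ (swapʳ (swapˡ s)))

    -- From i = j + l + 2w take A = -w, B = w + j and C = w + l: then A + B = j, A + C = l and B + C
    -- = i.
    split : ∀ {i j l} → point i ≡₂ point j ⊕ point l → Split j l i
    split {i} {j} {l} (w , w∈ , i≋) =
      (⊝ w) , (w ⊕ point j) , (w ⊕ point l) , (∈⊝ w∈ , ∈⊕ w∈ (point∈ j) , ∈⊕ w∈ (point∈ l)) ,
      add-back (point j) , add-back (point l) ,
      ≋-trans i≋ (≋-trans (comm (point j ⊕ point l) (w ⊕ w)) (interchange w w (point j) (point l)))
      where
      add-back : ∀ x → x ≋ (⊝ w) ⊕ (w ⊕ x)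
      add-back x = ≋-sym (≋-trans (≋-sym (assoc (⊝ w) w x))
        (≋-trans (∙-congʳ (inverseˡ w)) (identityˡ x)))

  -- The gap `o` of least reach is set aside by `punchIn` and accounts for the 1. The other g points
  -- are sum-free modulo 2, whence 2g ≤ 2^(d+1).
  gapSystem-bound : ∀ {d g} → HasDimension d → GapSystem g → g ≤ℕ suc (2 ^ d)
  gapSystem-bound {d} {zero}  _   _ = ℕ.z≤n
  gapSystem-bound {d} {suc g} dim S = ℕ.s≤s (double-cancel-≤
    (subst (g ℕ.+ g ≤ℕ_) (cong (2 ^ d ℕ.+_) (ℕ.+-identityʳ (2 ^ d)))
      (sum-free-bound (classes dim) (λ i → point (punchIn o i)) (λ i → point∈ (punchIn o i))
        (λ i → not-congruent S o o-least (o≢ i) ℕ.z≤n 0≤o (vec≉0 (punchIn o i)))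
        (λ i j i≢j → not-congruent S o o-least (o≢ i)
          (ℕ.≤-trans (level≤reach (punchIn o j)) (reach≤ (punchIn o j) o))
          (antitone (o-least (punchIn o j)))
          (λ i≈j → injective i≢j (distinct (sq-cong i≈j))))
        (λ i j l i≢j i≢l j≢l h → no-split S o o-least (o≢ j) (o≢ l) (o≢ i)
          (injective j≢l) (injective (≢-sym i≢j)) (injective (≢-sym i≢l))
          (split S o o-least h)))))
    where
    open GapSystem S
    o = proj₁ (argmin reach)
    o-least = proj₂ (argmin reach)
    o≢ : ∀ i → o ≢ punchIn o i
    o≢ i eq = punchInᵢ≢i o i (sym eq)
    injective : ∀ {i j} → i ≢ j → punchIn o i ≢ punchIn o j
    injective i≢j eq = i≢j (punchIn-injective o _ _ eq)
    0≤o : sq 0ᴹ ≤ sq (vec o)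
    0≤o = ≤-resp-≈ (≈-sym (⟨⟩-zeroˡ 0ᴹ)) ≈-refl (⟨⟩-nonNeg (vec o))

  -- From a gap count to a gap system

  reachOf : (n N : ℕ) → ℕ
  reachOf n N = (n ℕ.∸ 1) ℕ.⊔ (N ℕ.∸ n)

  ∣m⊖n∣≤reach : ∀ {m n N} → 1 ≤ℕ m → m ≤ℕ N → ℤ.∣ m ⊖ n ∣ ≤ℕ reachOf n N
  ∣m⊖n∣≤reach {m} {n} {N} 1≤m m≤N with ℕ.≤-total m n
  ... | inj₁ m≤n = subst (_≤ℕ reachOf n N) (sym (ℤ.∣⊖∣-≤ m≤n))
    (ℕ.≤-trans (ℕ.∸-monoʳ-≤ n 1≤m) (ℕ.m≤m⊔n (n ℕ.∸ 1) (N ℕ.∸ n)))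
  ... | inj₂ n≤m = subst (_≤ℕ reachOf n N)
    (sym (trans (ℤ.∣m⊖n∣≡∣n⊖m∣ m n) (ℤ.∣⊖∣-≤ n≤m)))
    (ℕ.≤-trans (ℕ.∸-monoˡ-≤ n m≤N) (ℕ.m≤n⊔m (n ℕ.∸ 1) (N ℕ.∸ n)))

  reach≤N∸1 : ∀ {n N} → 1 ≤ℕ n → n ≤ℕ N → reachOf n N ≤ℕ N ℕ.∸ 1
  reach≤N∸1 {n} {N} 1≤n n≤N = ℕ.⊔-lub (ℕ.∸-monoˡ-≤ 1 n≤N) (ℕ.∸-monoʳ-≤ N 1≤n)

  -- N - 1 is the sum of n - 1 and N - n, and neither exceeds the reach. With `reach≤N∸1` this keeps
  -- any two reaches within a factor 2.
  N∸1≤2reach : ∀ {n N} → 1 ≤ℕ n → n ≤ℕ N → N ℕ.∸ 1 ≤ℕ reachOf n N ℕ.+ reachOf n N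
  N∸1≤2reach {suc n} {N} _ n<N = ℕ.≤-trans
    (ℕ.≤-reflexive (sym (cong (ℕ._∸ 1) (ℕ.m+[n∸m]≡n {suc n} n<N))))
    (ℕ.+-mono-≤ (ℕ.m≤m⊔n n (N ℕ.∸ suc n)) (ℕ.m≤n⊔m n (N ℕ.∸ suc n)))

  reflect : ∀ {k v} → (k , v) ∈Λ →
            ∃[ w ] (+ ℤ.∣ k ∣ , w) ∈Λ × sq w ≈ sq v × (w ≈ᴹ 0ᴹ → v ≈ᴹ 0ᴹ)
  reflect {+ n}      {v} v∈ = v , v∈ , ≈-refl , λ v≈0 → v≈0
  reflect { -[1+ n ]} {v} v∈ = -ᴹ v , ∈⊝ v∈ , sq-neg v , -v≈0⇒v≈0
    where
    -v≈0⇒v≈0 : -ᴹ v ≈ᴹ 0ᴹ → v ≈ᴹ 0ᴹ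
    -v≈0⇒v≈0 h = ≈ᴹ-trans (≈ᴹ-sym (+ᴹ-identityʳ v))
      (≈ᴹ-trans (+ᴹ-congˡ (≈ᴹ-sym h)) (-ᴹ‿inverseʳ v))

  distance∈ : ∀ {n N m w} → 1 ≤ℕ m → m ≤ℕ N → (m ⊖ n , w) ∈Λ → ¬ w ≈ᴹ 0ᴹ →
              ∃[ x ] x ∈ Distances V ℒ α n N × x ≈ √ sq w
  distance∈ {n} {N} {m} {w} 1≤m m≤N (member (ℓ , ℓ∈ , w≈)) w≉0 =
    ‖ fromℤ (m ⊖ n) *ₗ α +ᴹ ℓ ‖ ,
    (m , ℓ , (1≤m , m≤N) , ℓ∈ , (λ h → w≉0 (≈ᴹ-trans w≈ h)) , ≈-refl) ,
    √-cong (sq-cong (≈ᴹ-sym w≈))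

  -- The levels m - n fill the range from 1 - n to N - n, which need not be symmetric. By `reflect`
  -- and negation the sign of k can be chosen: m = n - |k| is admissible when the reach is n - 1,
  -- and m = n + |k| when it is N - n.
  gap-minimal : ∀ {n N x} → 1 ≤ℕ n → n ≤ℕ N → x ∈ IsGap V ℒ α n N →
    ∀ {k w} → (k , w) ∈Λ → ¬ w ≈ᴹ 0ᴹ → ℤ.∣ k ∣ ≤ℕ reachOf n N → x ≤ √ sq w
  gap-minimal {n} {N} {x} 1≤n n≤N (_ , x≤) {k} {w} w∈ w≉0 k≤
    with reflect w∈ | ℕ.⊔-sel (n ℕ.∸ 1) (N ℕ.∸ n)
  ... | u , u∈ , u~w , u≈0⇒ | inj₁ eq =
    let k≤n∸1        = subst (ℤ.∣ k ∣ ≤ℕ_) eq k≤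
        k<n          = ℕ.≤-trans (ℕ.s≤s k≤n∸1) (ℕ.≤-reflexive (ℕ.m+[n∸m]≡n 1≤n))
        k≤n          = ℕ.<⇒≤ k<n
        level        = trans (ℤ.⊖-≤ (ℕ.m∸n≤m n ℤ.∣ k ∣))
                         (cong (λ i → ℤ.- (+ i)) (ℕ.m∸[m∸n]≡n k≤n))
        y , y∈ , y≈  = distance∈ {n} (ℕ.m<n⇒0<n∸m k<n) (ℕ.≤-trans (ℕ.m∸n≤m n ℤ.∣ k ∣) n≤N)
                         (subst (λ i → (i , -ᴹ u) ∈Λ) (sym level) (∈⊝ u∈))
                         (λ h → w≉0 (u≈0⇒ (≈ᴹ-trans (≈ᴹ-sym (+ᴹ-identityʳ u))
                           (≈ᴹ-trans (+ᴹ-congˡ (≈ᴹ-sym h)) (-ᴹ‿inverseʳ u)))))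
    in ≤-resp-≈ ≈-refl (≈-trans y≈ (√-cong (≈-trans (sq-neg u) u~w))) (x≤ y y∈)
  ... | u , u∈ , u~w , u≈0⇒ | inj₂ eq =
    let k≤N∸n        = subst (ℤ.∣ k ∣ ≤ℕ_) eq k≤
        level        = trans (ℤ.⊖-≥ (ℕ.m≤m+n n ℤ.∣ k ∣)) (cong +_ (ℕ.m+n∸m≡n n ℤ.∣ k ∣))
        y , y∈ , y≈  = distance∈ {n} (ℕ.≤-trans 1≤n (ℕ.m≤m+n n ℤ.∣ k ∣))
                         (ℕ.≤-trans (ℕ.+-monoʳ-≤ n k≤N∸n) (ℕ.≤-reflexive (ℕ.m+[n∸m]≡n n≤N)))
                         (subst (λ i → (i , u) ∈Λ) (sym level) u∈)
                         (λ h → w≉0 (u≈0⇒ h))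
    in ≤-resp-≈ ≈-refl (≈-trans y≈ (√-cong u~w)) (x≤ y y∈)

  gapSystem : ∀ {N g} → IsGapCount V ℒ α N g → GapSystem g
  gapSystem {N} {g} (f , f-injective , f∈ , _) = record
    { reach       = λ i → reachOf (n i) N
    ; level       = λ i → ℤ.∣ m i ⊖ n i ∣
    ; vec         = λ i → proj₁ (vector i)
    ; point∈      = λ i → proj₁ (proj₂ (vector i))
    ; level≤reach = λ i → ∣m⊖n∣≤reach {n = n i} (proj₁ (1≤m≤N i)) (proj₂ (1≤m≤N i))
    ; vec≉0       = λ i h → v≉0 i (proj₂ (proj₂ (proj₂ (vector i))) h)
    ; minimal     = λ i {k} {w} w∈ w≉0 k≤ → √-cancel-≤ (⟨⟩-nonNeg (proj₁ (vector i))) (⟨⟩-nonNeg w)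
                      (≤-resp-≈ (f≈ i) ≈-refl
                        (gap-minimal (proj₁ (1≤n≤N i)) (proj₂ (1≤n≤N i)) (isGap i) w∈ w≉0 k≤))
    ; distinct    = λ {i} {j} h → f-injective (≈-trans (f≈ i) (≈-trans (√-cong h) (≈-sym (f≈ j))))
    ; reach≤      = λ i j → ℕ.≤-trans (reach≤N∸1 (proj₁ (1≤n≤N i)) (proj₂ (1≤n≤N i)))
                      (N∸1≤2reach (proj₁ (1≤n≤N j)) (proj₂ (1≤n≤N j)))
    }
    where
    n : Fin g → ℕ
    n i = proj₁ (f∈ i)
    1≤n≤N : ∀ i → 1 ≤ℕ n i × n i ≤ℕ N
    1≤n≤N i = proj₁ (proj₂ (f∈ i))
    isGap : ∀ i → f i ∈ IsGap V ℒ α (n i) N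
    isGap i = proj₂ (proj₂ (f∈ i))
    attained : ∀ i → f i ∈ Distances V ℒ α (n i) N
    attained i = proj₁ (isGap i)
    m : Fin g → ℕ
    m i = proj₁ (attained i)
    1≤m≤N : ∀ i → 1 ≤ℕ m i × m i ≤ℕ N
    1≤m≤N i = proj₁ (proj₂ (proj₂ (attained i)))
    v : Fin g → Carrier
    v i = fromℤ (m i ⊖ n i) *ₗ α +ᴹ proj₁ (proj₂ (attained i))
    v≉0 : ∀ i → ¬ v i ≈ᴹ 0ᴹ
    v≉0 i = proj₁ (proj₂ (proj₂ (proj₂ (proj₂ (attained i)))))
    vector : ∀ i → _
    vector i = reflect {m i ⊖ n i} {v i}
      (member (_ , proj₁ (proj₂ (proj₂ (proj₂ (attained i)))) , ≈ᴹ-refl))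
    f≈ : ∀ i → f i ≈ √ sq (proj₁ (vector i))
    f≈ i = ≈-trans (proj₂ (proj₂ (proj₂ (proj₂ (proj₂ (attained i))))))
      (√-cong (≈-sym (proj₁ (proj₂ (proj₂ (vector i))))))

gapCount≤1+2^d : ∀ {a b p d} (V : InnerProductSpace a b) → InnerProductSpace.HasDimension V d →
  (ℒ : Lattice V p) (α : InnerProductSpace.Carrier V) (N : ℕ) →
  ∀ g → IsGapCount V ℒ α N g → g ≤ℕ suc (2 ^ d)
gapCount≤1+2^d V dim ℒ α N g count = gapSystem-bound dim (gapSystem count)
  where open GapCount V ℒ α

theorem1p2 : ∀ {a b p} (V : InnerProductSpace a b) → InnerProductSpace.HasDimension V 3 →
    (ℒ : Lattice V p) (α : InnerProductSpace.Carrier V) (N : ℕ) → 2 ≤ℕ N →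
    ∀ g → IsGapCount V ℒ α N g → g ≤ℕ 9
theorem1p2 V dim ℒ α N _ = gapCount≤1+2^d V dim ℒ α N
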